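{- Let $\Sigma$ be a surface of Euler genus $k(\Sigma)$ and let $H$ be a hypergraph on $\Sigma$ which is connected, has at least two hyperedges, has no pending vertex and has no cut-edge. Then \[ \operatorname{tw}(H^*)\leq\max\bigl(\operatorname{tw}(H)+1+k(\Sigma),\ \alpha(H^*)-1\bigr), \] where $H^*$ is the dual hypergraph of $H$ and $\alpha(H^*)$ is the maximum number of vertices incident with a hyperedge of $H^*$.
   Context: A surface is a connected compact 2-manifold without boundary; up to homeomorphism it is obtained from the sphere by adding $k(\Sigma)$ crosscaps, and $k(\Sigma)$ is its Euler genus. A graph on $\Sigma$ is a drawing of a graph in $\Sigma$ (vertices are points, edges are pairwise disjoint open curves between vertices); its faces are the connected components of the complement of the drawing, and only 2-cell drawings (all faces homeomorphic to open discs) are considered. A hypergraph on $\Sigma$ is obtained from a 2-cell bipartite graph on $\Sigma$ with bipartition $(V, V_E)$ by merging each $v_e\in V_E$ (the center) with its incident edges into a hyperedge $e$; $V$ is the vertex set and $E$ the set of hyperedges. The atoms of $H$ are its vertices, hyperedges (viewed as subsets of $\Sigma$) and faces; they partition $\Sigma$. A vertex is pending if it is incident with only one hyperedge. A hyperedge $e$ is a cut-edge if $H$ meets at least two connected components of $\Sigma\setminus\bar e$. The dual $H^*$ has one vertex $v_f$ for each face $f$ of $H$, and for each hyperedge $e$ with center $v_e$, choosing a local orientation around $v_e$ gives a cyclic order $v_1,f_1,\dots,v_d,f_d$ of the ends of $e$ and incident faces; $e^*$ is the hyperedge obtained by rotating $e$, with ends $v_{f_1},\dots,v_{f_d}$.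 A tree-decomposition of a hypergraph is a tree $T$ with bags $X_t\subseteq V$ ($t\in V(T)$) such that every vertex and the vertex set of every hyperedge lie in some bag, and for $y$ on the path from $x$ to $z$ in $T$, $X_x\cap X_z\subseteq X_y$; its width is $\max_t |X_t|-1$, and $\operatorname{tw}$ denotes the minimum width. -}

module Defs where

open import Data.Nat using (ℕ; zero; suc; _+_; _≤_; _∸_; _⊔_)
open import Data.Fin using (Fin)
open import Data.Bool using (Bool; true; false)
open import Data.List using (List; length; head; last)
open import Data.List.Membership.Propositional using (_∈_)
open import Data.List.Relation.Unary.Linked using (Linked)
open import Data.List.Relation.Unary.Unique.Propositional using (Unique)
open import Data.Maybe using (just)
open import Data.Product using (Σ; ∃; _×_; ∃-syntax)
open import Data.Sum using (_⊎_)
open import Data.Unit using (⊤)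
open import Relation.Binary.PropositionalEquality using (_≡_; _≢_)
open import Relation.Binary.Construct.Closure.Equivalence using (EqClosure)
open import Relation.Nullary using (¬_)

-- Combinatorial encoding of 2-cell drawings on surfaces.
--
-- A 2-cell drawing of a connected graph on a surface (closed, possibly
-- non-orientable) is encoded, as usual, by a generalized map: a finite set
-- of flags (triangles of the barycentric subdivision) with three
-- fixed-point-free involutions a0, a1, a2 such that a0 a2 is a
-- fixed-point-free involution, and the group <a0,a1,a2> acts transitively.
--   vertices = orbits of <a1,a2>, edges = orbits of <a0,a2>,
--   faces    = orbits of <a0,a1>.

record GMap : Set where
  field
    n        : ℕ
    a0 a1 a2 : Fin n → Fin n
    a0-inv   : ∀ x → a0 (a0 x) ≡ x
    a1-inv   : ∀ x → a1 (a1 x) ≡ x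
    a2-inv   : ∀ x → a2 (a2 x) ≡ x
    a0-free  : ∀ x → a0 x ≢ x
    a1-free  : ∀ x → a1 x ≢ x
    a2-free  : ∀ x → a2 x ≢ x
    a02-inv  : ∀ x → a0 (a2 (a0 (a2 x))) ≡ x
    a02-free : ∀ x → a0 (a2 x) ≢ x

  Step01 Step12 Step02 Step012 : Fin n → Fin n → Set
  Step01 x y = y ≡ a0 x ⊎ y ≡ a1 x
  Step12 x y = y ≡ a1 x ⊎ y ≡ a2 x
  Step02 x y = y ≡ a0 x ⊎ y ≡ a2 x
  Step012 x y = y ≡ a0 x ⊎ y ≡ a1 x ⊎ y ≡ a2 x

  SameFace SameNode SameEdge : Fin n → Fin n → Set
  SameFace = EqClosure Step01
  SameNode = EqClosure Step12
  SameEdge = EqClosure Step02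

  Connected : Set
  Connected = ∀ x y → EqClosure Step012 x y

NumClasses : (n : ℕ) → (Fin n → Fin n → Set) → ℕ → Set
NumClasses n R c =
  Σ (List (Fin n)) λ reps → length reps ≡ c × Unique reps
    × (∀ {x y} → x ∈ reps → y ∈ reps → R x y → x ≡ y)
    × (∀ x → ∃[ r ] (r ∈ reps × R x r))

-- Hypergraphs on a surface: a 2-cell bipartite graph (V , V_E) given by a
-- generalized map together with the bipartition; col x = true means the
-- node of flag x is a hyperedge center (in V_E), false: a vertex (in V).

record SurfaceHypergraph : Set where
  field
    map   : GMap
  open GMap map public
  field
    col       : Fin n → Bool
    col-a1    : ∀ x → col (a1 x) ≡ col x
    col-a2    : ∀ x → col (a2 x) ≡ col x
    col-a0    : ∀ x → col (a0 x) ≢ col x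
    connected : Connected

  IsVertex IsHyperedge : Fin n → Set
  IsVertex x = col x ≡ false
  IsHyperedge x = col x ≡ true

  Incident : Fin n → Fin n → Set
  Incident e v = ∃[ g ] (SameNode e g × SameNode (a0 g) v)

  FaceIncident : Fin n → Fin n → Set
  FaceIncident e f = ∃[ g ] (SameNode e g × SameFace g f)

  -- Euler genus k(Σ) = 2 - χ, χ = #nodes - #edges + #faces
  EulerGenus : ℕ → Set
  EulerGenus k = ∃[ nN ] ∃[ nE ] ∃[ nF ]
    (NumClasses n SameNode nN × NumClasses n SameEdge nE
      × NumClasses n SameFace nF × k + nN + nF ≡ 2 + nE)

  Pending : Fin n → Set
  Pending v = IsVertex v × (∀ g h → SameNode v g → SameNode v h
                               → SameNode (a0 g) (a0 h))

  AtLeastTwoHyperedges : Set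
  AtLeastTwoHyperedges =
    ∃[ e ] ∃[ e' ] (IsHyperedge e × IsHyperedge e' × ¬ SameNode e e')

  EdgeIn : Fin n → Fin n → Set
  EdgeIn e x = SameNode e x ⊎ SameNode e (a0 x)

  -- Two flags (triangles of the barycentric subdivision) lie in the same
  -- component of Σ ∖ closure(e): generated by crossing sides not in
  -- closure(e) (a0- and a1-sides always; a2-sides unless on an edge of e).
  CutStep : Fin n → Fin n → Fin n → Set
  CutStep e x y = y ≡ a0 x ⊎ y ≡ a1 x ⊎ (y ≡ a2 x × ¬ EdgeIn e x)

  -- e is a cut-edge: H meets two different components of Σ ∖ closure(e).
  -- A component meets H iff it contains a flag whose edge is not in e.
  CutEdge : Fin n → Set
  CutEdge e = IsHyperedge e × ∃[ x ] ∃[ y ]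
    (¬ EdgeIn e x × ¬ EdgeIn e y × ¬ EqClosure (CutStep e) x y)

-- Abstract (finite) hypergraph given by representatives in Fin n:
--   IsV x  : x represents a vertex,  SameV : vertex identity,
--   IsE e  : e represents a hyperedge, Inc e v : v is an end of e.

record HG (n : ℕ) : Set₁ where
  field
    IsV   : Fin n → Set
    SameV : Fin n → Fin n → Set
    IsE   : Fin n → Set
    Inc   : Fin n → Fin n → Set

record Tree (m : ℕ) : Set₁ where
  field
    Adj     : Fin m → Fin m → Set
    symm    : ∀ {x y} → Adj x y → Adj y x
    irrefl  : ∀ {x} → ¬ Adj x x

  PathFrom : Fin m → Fin m → List (Fin m) → Set
  PathFrom x z p = head p ≡ just x × last p ≡ just z × Linked Adj p × Unique p

  field
    nonempty  : 1 ≤ m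
    connected : ∀ x z → ∃[ p ] PathFrom x z p
    acyclic   : ∀ (p : List (Fin m)) → 3 ≤ length p → Linked Adj p → Unique p
                  → ∀ {x z} → head p ≡ just x → last p ≡ just z → ¬ Adj z x

  OnPath : Fin m → Fin m → Fin m → Set
  OnPath x y z = ∃[ p ] (PathFrom x z p × y ∈ p)

-- H has a tree-decomposition of width ≤ w (i.e. tw(H) ≤ w).
-- Bags are lists of vertex representatives; |X_t| ≤ w + 1.
record TreeDecomposition {n : ℕ} (H : HG n) (w : ℕ) : Set₁ where
  open HG H
  field
    m    : ℕ
    T    : Tree m
    bag  : Fin m → List (Fin n)
  InBag : Fin n → Fin m → Set
  InBag v t = ∃[ u ] (u ∈ bag t × SameV u v)
  field
    bag-vertices : ∀ t {u} → u ∈ bag t → IsV u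
    width        : ∀ t → length (bag t) ≤ suc w
    cover-vertex : ∀ v → IsV v → ∃[ t ] InBag v t
    cover-edge   : ∀ e → IsE e → ∃[ t ] (∀ v → IsV v → Inc e v → InBag v t)
    interpolate  : ∀ x y z → Tree.OnPath T x y z
                     → ∀ v → InBag v x → InBag v z → InBag v y

module _ (H : SurfaceHypergraph) where
  open SurfaceHypergraph H

  primalHG : HG n
  primalHG = record { IsV = IsVertex ; SameV = SameNode
                    ; IsE = IsHyperedge ; Inc = Incident }

  dualHG : HG n
  dualHG = record { IsV = λ _ → ⊤ ; SameV = SameFace
                  ; IsE = IsHyperedge ; Inc = FaceIncident }

  DualRankAtMost : ℕ → Set
  DualRankAtMost a = ∀ e → IsHyperedge e →
    ∃[ reps ] (length reps ≤ a × (∀ f → FaceIncident e f → ∃[ r ] (r ∈ reps × SameFace f r)))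

{-# OPTIONS --safe #-}
module Submission where

-- Call two hyperedges adjacent when they share a face; e not being a cut-edge means that
-- deleting e leaves this adjacency graph M connected.  A bond is a set of hyperedges which is
-- connected in M and whose complement is connected in M.
--
-- A tree-decomposition of H is turned into a binary tree whose leaves are the hyperedges, all
-- of whose edges are bonds, and such that at each inner node every vertex incident with two of
-- the three parts lies in a single bag.  To this end the decomposition tree is contracted leaf by
-- leaf.  At each node the hyperedges are coloured by branch, adjacent hyperedges of
-- different colours meet only in vertices of the bag, and a bond that is a union of
-- monochromatic components is either split into two smaller such bonds or is
-- one monochromatic component together with components of its complement.
--
-- Replacing each node of that tree by the faces that meet at least two of its parts, and each
-- leaf by the faces of its hyperedge, gives a tree-decomposition of the dual.  The bags are small
-- because, for a partition into three connected parts with V_b border vertices and F_b border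
-- faces, F_b ≤ V_b + 1 + k.  Indeed, split each face into one copy for each colour in the incidence
-- graph of hyperedges and faces: the three parts give three connected graphs, with
-- at least h + n_F + F_b nodes and n_E edges.  Inner vertices bound closed walks in these
-- graphs which are independent, so one edge for each of them can be deleted without disconnecting
-- anything: n_E ≥ (h + n_F + F_b - 3) + (n_V - V_b), and Euler's formula finishes.

open import Defs
open import Data.Nat using (ℕ; _+_; _∸_; _⊔_)
open import Relation.Nullary using (¬_)
open SurfaceHypergraph using (EulerGenus; AtLeastTwoHyperedges; Pending; CutEdge)

open import Algebra.Bundles using (CommutativeRing)
import Algebra.Properties.CommutativeMonoid.Sum as CommutativeMonoidSum
open import Data.Bool using (Bool; true; false; not; _∧_; _xor_) renaming (_≟_ to _≟ᵇ_)
open import Data.Bool.Properties using (¬-not; ∧-distribˡ-xor; ∧-zeroʳ; xor-same; xor-∧-commutativeRing)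
open import Data.Empty using (⊥; ⊥-elim)
open import Data.Fin using (Fin; zero; suc; _≟_; _<_; _<?_)
open import Data.Fin.Patterns using (0F; 1F; 2F)
open import Data.Fin.Permutation using (Permutation; permutation)
open import Data.Fin.Properties using (any?; suc-injective; <-cmp)
open import Data.Fin.Subset using (Subset; _⊆_; _⊂_; _⊃_; Nonempty; ⁅_⁆)
  renaming (_∈_ to _∈ˢ_; _∉_ to _∉ˢ_)
open import Data.Fin.Subset.Induction using (⊂-wellFounded; ⊃-wellFounded; Acc; acc)
open import Data.Fin.Subset.Properties using (⊆-antisym; x∈⁅x⁆; x∈⁅y⁆⇒x≡y)
  renaming (_∈?_ to _∈ˢ?_)
open import Data.List
  using (List; []; _∷_; _++_; _ʳ++_; allFin; filter; head; last; length; lookup; map; reverse)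
import Data.List.Membership.DecPropositional as DecMembership
open import Data.List.Membership.Propositional using (_∈_; _∉_; find; lose)
open import Data.List.Membership.Propositional.Properties
  using (∈-∃++; ∈-++⁺ˡ; ∈-++⁺ʳ; ∈-++⁻; ∈-allFin; ∈-filter⁺; ∈-filter⁻; ∈-lookup; ∈-map⁺; ∈-map⁻)
open import Data.List.Properties using (length-++; length-map; length-tabulate)
import Data.List.Relation.Unary.All as All
open import Data.List.Relation.Unary.All using (All; []; _∷_)
import Data.List.Relation.Unary.All.Properties as All
open import Data.List.Relation.Unary.AllPairs using ([]; _∷_)
import Data.List.Relation.Unary.Any as Any
open import Data.List.Relation.Unary.Any using (here; there)
open import Data.List.Relation.Unary.Any.Properties using (lookup-index; reverse⁺)
open import Data.List.Relation.Unary.Linked using (Linked; []; [-]; _∷_)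
import Data.List.Relation.Unary.Linked.Properties as Linked
open import Data.List.Relation.Unary.Unique.Propositional using (Unique)
import Data.List.Relation.Unary.Unique.Propositional.Properties as Unique
open import Data.Maybe using (Maybe; just; nothing)
open import Data.Maybe.Properties using (just-injective) renaming (≡-dec to maybe-≡-dec)
import Data.Maybe.Relation.Binary.Connected as Connected
open import Data.Nat using (suc; _*_; _≤_; z≤n; s≤s)
open import Data.Nat.Properties
  using (≤-trans; ≤-reflexive; +-suc; +-comm; +-assoc; +-identityʳ; +-mono-≤; +-monoˡ-≤;
         +-monoʳ-≤; +-cancelʳ-≤; *-cancelˡ-≤; n≤1+n; m≤m⊔n; m≤n⊔m; m≤n+m∸n; module ≤-Reasoning)
open import Data.Nat.Tactic.RingSolver using (solve-∀)
open import Data.Product using (∃; _×_; _,_; ∃-syntax; proj₁; proj₂)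
import Data.Product.Properties as Product
open import Data.Sum using (_⊎_; inj₁; inj₂; [_,_]′)
open import Data.Sum.Properties using (inj₁-injective; inj₂-injective)
  renaming (≡-dec to sum-≡-dec)
open import Data.Unit using (⊤; tt)
open import Data.Vec using (tabulate)
open import Data.Vec.Properties using (lookup∘tabulate; lookup⇒[]=; []=⇒lookup)
open import Function using (_∘_; _∋_)
open import Relation.Binary.Construct.Closure.Equivalence using (EqClosure; symmetric)
open import Relation.Binary.Construct.Closure.ReflexiveTransitive using (ε; _◅_; _◅◅_)
open import Relation.Binary.Construct.Closure.Symmetric using (fwd; bwd)
open import Relation.Binary.Definitions using (DecidableEquality; tri<; tri≈; tri>)
open import Relation.Binary.PropositionalEquality
  using (_≡_; _≢_; refl; sym; trans; cong; cong₂; subst; module ≡-Reasoning)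
open import Relation.Nullary using (Dec; yes; no; does)
open import Relation.Nullary.Decidable using (_×-dec_; _⊎-dec_; ¬?; dec-true; dec-false)
open import Relation.Unary using (Decidable)

-- Decidable predicates as finite subsets.

module _ {N : ℕ} where

  ⟪_⟫ : {P : Fin N → Set} → Decidable P → Subset N
  ⟪ P? ⟫ = tabulate (does ∘ P?)

  ∈⟪⟫⁺ : {P : Fin N → Set} (P? : Decidable P) → ∀ {x} → P x → x ∈ˢ ⟪ P? ⟫
  ∈⟪⟫⁺ P? {x} px =
    lookup⇒[]= x _ (trans (lookup∘tabulate (does ∘ P?) x) (dec-true (P? x) px))

  ∈⟪⟫⁻ : {P : Fin N → Set} (P? : Decidable P) → ∀ {x} → x ∈ˢ ⟪ P? ⟫ → P x
  ∈⟪⟫⁻ P? {x} x∈ with P? x | trans (sym (lookup∘tabulate (does ∘ P?) x)) ([]=⇒lookup x∈)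
  ... | yes px | _ = px
  ... | no _   | ()

-- Connected sets and their components.

module Bonds
  {N : ℕ} {_~_ : Fin N → Fin N → Set}
  (_~?_ : ∀ x y → Dec (x ~ y)) (~-sym : ∀ {x y} → x ~ y → y ~ x)
  where

  -- Connectedness is stated without paths: no set separates P.
  Conn : (Fin N → Set) → Set
  Conn P = ∀ (W : Subset N) {w} → w ∈ˢ W → P w
         → (∀ {x y} → x ∈ˢ W → P x → P y → x ~ y → y ∈ˢ W)
         → ∀ {x} → P x → x ∈ˢ W

  record Component (P : Fin N → Set) (D : Subset N) : Set where
    field
      within   : ∀ {x} → x ∈ˢ D → P x
      conn     : Conn (_∈ˢ D)
      nonempty : Nonempty D
      closed   : ∀ {x y} → x ∈ˢ D → P y → x ~ y → y ∈ˢ D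
  open Component

  -- Taking for `W` the set where `Q` holds turns the absence of separating sets into an induction
  -- along adjacencies, which replaces paths everywhere below.
  Conn-ind : {P Q : Fin N → Set} → Conn P → Decidable Q → ∀ {w} → P w → Q w
           → (∀ {x y} → Q x → P x → P y → x ~ y → Q y) → ∀ {x} → P x → Q x
  Conn-ind cP Q? Pw Qw step Px = ∈⟪⟫⁻ Q?
    (cP ⟪ Q? ⟫ (∈⟪⟫⁺ Q? Qw) Pw
      (λ x∈ Px Py x~y → ∈⟪⟫⁺ Q? (step (∈⟪⟫⁻ Q? x∈) Px Py x~y)) Px)

  Conn-resp : {P Q : Fin N → Set} → (∀ {x} → P x → Q x) → (∀ {x} → Q x → P x)
            → Conn P → Conn Q
  Conn-resp f g cP W w∈ Qw cl Qx =
    cP W w∈ (g Qw) (λ x∈ Px Py → cl x∈ (f Px) (f Py)) (g Qx)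

  Conn-singleton : ∀ e → Conn (_∈ˢ ⁅ e ⁆)
  Conn-singleton e W w∈ w∈e _ x∈e =
    subst (_∈ˢ W) (trans (x∈⁅y⁆⇒x≡y e w∈e) (sym (x∈⁅y⁆⇒x≡y e x∈e))) w∈

  Conn-union : {P Q R : Fin N → Set} → Conn P → Conn Q
             → (∀ {x} → P x → R x) → (∀ {x} → Q x → R x) → (∀ {x} → R x → P x ⊎ Q x)
             → ∀ {p q} → P p → Q q → p ~ q → Conn R
  Conn-union {P} {Q} {R} cP cQ P⊆R Q⊆R R⊆ {p} {q} Pp Qq p~q W {w} w∈ Rw cl Rx = go (R⊆ Rw) (R⊆ Rx)
    where
    fromP : ∀ {w} → w ∈ˢ W → P w → ∀ {x} → P x → x ∈ˢ W
    fromP w∈ Pw = cP W w∈ Pw (λ x∈ Px Py → cl x∈ (P⊆R Px) (P⊆R Py))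
    fromQ : ∀ {w} → w ∈ˢ W → Q w → ∀ {x} → Q x → x ∈ˢ W
    fromQ w∈ Qw = cQ W w∈ Qw (λ x∈ Px Py → cl x∈ (Q⊆R Px) (Q⊆R Py))
    go : ∀ {x} → P w ⊎ Q w → P x ⊎ Q x → x ∈ˢ W
    go (inj₁ Pw) (inj₁ Px) = fromP w∈ Pw Px
    go (inj₁ Pw) (inj₂ Qx) = fromQ (cl (fromP w∈ Pw Pp) (P⊆R Pp) (Q⊆R Qq) p~q) Qq Qx
    go (inj₂ Qw) (inj₁ Px) =
      fromP (cl (fromQ w∈ Qw Qq) (Q⊆R Qq) (P⊆R Pp) (~-sym p~q)) Pp Px
    go (inj₂ Qw) (inj₂ Qx) = fromQ w∈ Qw Qx

  -- A connected set is grown from `v` by one neighbour at a time; it strictly increases, so growth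
  -- stops, and it stops only when no adjacency inside `P` leaves the set.
  component-of : {P : Fin N → Set} → Decidable P → ∀ {v} → P v
               → ∃[ D ] (Component P D × v ∈ˢ D)
  component-of {P} P? {v} Pv =
    grow ⁅ v ⁆ (⊃-wellFounded ⁅ v ⁆) (λ x∈ → subst P (sym (x∈⁅y⁆⇒x≡y v x∈)) Pv)
      (Conn-singleton v) (x∈⁅x⁆ v)
    where
    grow : ∀ C → Acc _⊃_ C → (∀ {x} → x ∈ˢ C → P x) → Conn (_∈ˢ C) → v ∈ˢ C
         → ∃[ D ] (Component P D × v ∈ˢ D)
    grow C (acc rec) C⊆P cC v∈C
      with any? (λ x → any? (λ y → ((x ∈ˢ? C) ×-dec ¬? (y ∈ˢ? C)) ×-dec (P? y ×-dec (x ~? y))))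
    ... | no none = C , comp , v∈C
      where
      comp : Component P C
      comp .within = C⊆P
      comp .conn = cC
      comp .nonempty = v , v∈C
      comp .closed {x} {y} x∈C Py x~y with y ∈ˢ? C
      ... | yes y∈C = y∈C
      ... | no y∉C  = ⊥-elim (none (x , y , (x∈C , y∉C) , Py , x~y))
    ... | yes (x , y , (x∈C , y∉C) , Py , x~y) =
      grow C' (rec ((λ z∈ → ∈⟪⟫⁺ C'? (inj₁ z∈)) , y , ∈⟪⟫⁺ C'? (inj₂ (x∈⁅x⁆ y)) , y∉C))
        C'⊆P
        (Conn-union cC (Conn-singleton y) (∈⟪⟫⁺ C'? ∘ inj₁) (∈⟪⟫⁺ C'? ∘ inj₂) (∈⟪⟫⁻ C'?)
          x∈C (x∈⁅x⁆ y) x~y)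
        (∈⟪⟫⁺ C'? (inj₁ v∈C))
      where
      C'? : Decidable (λ z → z ∈ˢ C ⊎ z ∈ˢ ⁅ y ⁆)
      C'? z = (z ∈ˢ? C) ⊎-dec (z ∈ˢ? ⁅ y ⁆)
      C' : Subset N
      C' = ⟪ C'? ⟫
      C'⊆P : ∀ {z} → z ∈ˢ C' → P z
      C'⊆P z∈ with ∈⟪⟫⁻ C'? z∈
      ... | inj₁ z∈C = C⊆P z∈C
      ... | inj₂ z∈y = subst P (sym (x∈⁅y⁆⇒x≡y y z∈y)) Py

  -- Every component of P ∖ U is joined to U, so deleting one of them leaves the rest
  -- attached to the connected set U.
  Conn-minus-component :
    {P : Fin N → Set} {U D : Subset N} → Conn P → Conn (_∈ˢ U) → Nonempty U
    → (∀ {x} → x ∈ˢ U → P x) → Component (λ x → P x × x ∉ˢ U) D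
    → Conn (λ x → P x × x ∉ˢ D)
  Conn-minus-component {P} {U} {D} cP cU (u₀ , u₀∈U) U⊆P comp W {w} w∈W (Pw , w∉D) cl
    {x} (Px , x∉D) = conclude
    where
    U∉D : ∀ {u} → u ∈ˢ U → u ∉ˢ D
    U∉D u∈U u∈D = proj₂ (within comp u∈D) u∈U
    meets : ∃[ u ] (u ∈ˢ U × u ∈ˢ W)
    -- If `W` avoided `U`, then `W` minus `D` could never be left by a step into `D`, since only
    -- points of `U` have neighbours in `D`. It would spread through `P` as far as `u₀`, which is
    -- then a common point after all.
    meets with any? (λ u → (u ∈ˢ? U) ×-dec (u ∈ˢ? W))
    ... | yes m = m
    ... | no none = u₀ , u₀∈U ,
        proj₁ (Conn-ind cP (λ z → (z ∈ˢ? W) ×-dec ¬? (z ∈ˢ? D)) Pw (w∈W , w∉D) step (U⊆P u₀∈U))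
      where
      step : ∀ {z y} → z ∈ˢ W × z ∉ˢ D → P z → P y → z ~ y → y ∈ˢ W × y ∉ˢ D
      step {z} {y} (z∈W , z∉D) Pz Py z~y = cl z∈W (Pz , z∉D) (Py , y∉D) z~y , y∉D
        where
        y∉D : y ∉ˢ D
        y∉D y∈D = z∉D (closed comp y∈D (Pz , λ z∈U → none (z , z∈U , z∈W)) (~-sym z~y))
    U⊆W : ∀ {u} → u ∈ˢ U → u ∈ˢ W
    U⊆W = let u , u∈U , u∈W = meets in
      cU W u∈W u∈U (λ a∈W a∈U b∈U → cl a∈W (U⊆P a∈U , U∉D a∈U) (U⊆P b∈U , U∉D b∈U))
    conclude : x ∈ˢ W
    conclude with x ∈ˢ? W
    ... | yes x∈W = x∈W
    -- The points outside both `W` and `D` avoid `U` too, so the same spreading argument would carry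
    -- `u₀` out of `W`.
    ... | no x∉W = ⊥-elim
        (proj₁ (Conn-ind cP (λ z → ¬? (z ∈ˢ? W) ×-dec ¬? (z ∈ˢ? D)) Px (x∉W , x∉D) step (U⊆P u₀∈U))
          (U⊆W u₀∈U))
      where
      step : ∀ {z y} → z ∉ˢ W × z ∉ˢ D → P z → P y → z ~ y → y ∉ˢ W × y ∉ˢ D
      step {z} {y} (z∉W , z∉D) Pz Py z~y = y∉W , y∉D
        where
        y∉D : y ∉ˢ D
        y∉D y∈D = z∉D (closed comp y∈D (Pz , λ z∈U → z∉W (U⊆W z∈U)) (~-sym z~y))
        y∉W : y ∉ˢ W
        y∉W y∈W = z∉W (cl y∈W (Py , y∉D) (Pz , z∉D) (~-sym z~y))

  -- Trees of bonds obtained from a colouring.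

  module Narrow
    (connected : Conn (λ _ → ⊤))
    {m : ℕ} {Sep : Fin m → Fin N → Fin N → Set}
    (Sep-sym : ∀ {t x y} → Sep t x y → Sep t y x)
    where

    SamePart : Subset N → Subset N → Subset N → Fin N → Fin N → Set
    SamePart X Y Z x y = (x ∈ˢ Y × y ∈ˢ Y) ⊎ (x ∈ˢ Z × y ∈ˢ Z) ⊎ (x ∉ˢ X × y ∉ˢ X)

    -- Good X: the hyperedges of X can be arranged as the leaves of a rooted binary tree
    -- all of whose edges are bonds, and such that the three-way partition at each
    -- inner node is separated by the bag of some node of the given tree.
    data Good (X : Subset N) : Set where
      leaf : ∀ e → e ∈ˢ X → (∀ {x} → x ∈ˢ X → x ≡ e) → Good X
      branch : ∀ Y Z → Y ⊆ X → Z ⊆ X → (∀ {x} → x ∈ˢ X → x ∈ˢ Y ⊎ x ∈ˢ Z)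
             → (∀ {x} → x ∈ˢ Y → x ∉ˢ Z)
             → Nonempty Y → Nonempty Z → (∃[ o ] o ∉ˢ X)
             → Conn (_∈ˢ Y) → Conn (_∈ˢ Z) → Conn (_∉ˢ X)
             → ∀ t → (∀ {x y} → x ~ y → ¬ SamePart X Y Z x y → Sep t x y)
             → Good Y → Good Z → Good X

    -- Once all but one of the components of the complement of C are good, so is the
    -- complement X of the remaining one.
    Fillable : Subset N → Set
    Fillable C = ∀ X → C ⊆ X → Conn (_∈ˢ X) → Conn (_∉ˢ X) → (∃[ o ] o ∉ˢ X)
      → (∀ {x y} → x ∈ˢ X → x ∉ˢ C → y ∉ˢ X → ¬ (x ~ y))
      → (∀ D → D ⊆ X → Component (_∉ˢ C) D → Good D) → Good X

    AllFillable : (Fin N → Set) → Set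
    AllFillable A = ∀ C → Component A C → Fillable C

    -- The only admissible `X` is `D` itself. A point of `X` outside `D` would let `X` spread
    -- through the connected complement of `D` up to `o`, because no adjacency leaves `X` from
    -- there.
    good-bond-fillable : ∀ {D} → Good D → Conn (_∉ˢ D) → Fillable D
    good-bond-fillable {D} gD cD X D⊆X _ _ (o , o∉X) noadj _ =
      subst Good (⊆-antisym D⊆X X⊆D) gD
      where
      X⊆D : X ⊆ D
      X⊆D {x} x∈X with x ∈ˢ? D
      ... | yes x∈D = x∈D
      ... | no x∉D = ⊥-elim (o∉X (cD X x∈X x∉D step (λ o∈D → o∉X (D⊆X o∈D))))
        where
        step : ∀ {a b} → a ∈ˢ X → a ∉ˢ D → b ∉ˢ D → a ~ b → b ∈ˢ X
        step {a} {b} a∈X a∉D b∉D a~b with b ∈ˢ? X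
        ... | yes b∈X = b∈X
        ... | no b∉X = ⊥-elim (noadj a∈X a∉D b∉X a~b)

    -- The case of `Conn-minus-component` in which `P` is everything. It makes the components of the
    -- complement of a connected set bonds.
    component-complement : ∀ {U D} → Conn (_∈ˢ U) → Nonempty U → Component (_∉ˢ U) D → Conn (_∉ˢ D)
    component-complement cU neU compD =
      Conn-resp proj₂ (tt ,_) (Conn-minus-component connected cU neU (λ _ → tt) compD')
      where
      compD' : Component (λ x → ⊤ × x ∉ˢ _) _
      compD' .within x∈ = tt , within compD x∈
      compD' .conn = conn compD
      compD' .nonempty = nonempty compD
      compD' .closed x∈ (_ , y∉) = closed compD x∈ y∉

    module Coloured
      {Colour : Set} (_≟ᶜ_ : DecidableEquality Colour) (c : Fin N → Colour) (t : Fin m)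
      (separates : ∀ {x y} → x ~ y → c x ≢ c y → Sep t x y)
      where

      -- These are the unions of monochromatic components.
      Saturated : Subset N → Set
      Saturated X = ∀ {x y} → x ∈ˢ X → c x ≡ c y → x ~ y → y ∈ˢ X

      Sat-resp : ∀ {X} → Saturated X → ∀ {x y} → x ∉ˢ X → c x ≡ c y → x ~ y → y ∉ˢ X
      Sat-resp sat x∉X eq x~y y∈X = x∉X (sat y∈X (sym eq) (~-sym x~y))

      -- Induction on `X`. Let `u` have a neighbour `o₁` outside `X`, and let `U` be its
      -- monochromatic component. If every adjacency leaving `X` starts in `U`, then `fill` applies,
      -- as the components of the complement of `U` inside `X` are smaller saturated bonds.
      -- Otherwise some `v` in `X` outside `U` has a neighbour `o₂` outside `X`. The component `Z`
      -- of `v` in `X` minus `U` and the rest `Y` are both connected and both touch the outside, so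
      -- they are bonds and `X` branches. The fixed `X₀` restricts the demand on `fill` to
      -- components that stay within the initial set.
      saturated-good :
        ∀ X₀ → (∀ U {u} → u ∈ˢ U → U ⊆ X₀ → Component (λ y → c y ≡ c u) U → Fillable U)
        → ∀ X → Acc _⊂_ X → X ⊆ X₀ → Saturated X → Conn (_∈ˢ X) → Conn (_∉ˢ X)
        → Nonempty X → (∃[ o ] o ∉ˢ X) → Good X
      saturated-good X₀ fill X (acc rec) X⊆X₀ satX cX c∁X (x₀ , x₀∈X) (o , o∉X)
        with any? (λ u → any? (λ y → ((u ∈ˢ? X) ×-dec ¬? (y ∈ˢ? X)) ×-dec (u ~? y)))
      -- Without an adjacency leaving it, `X` would contain everything, in particular `o`.
      ... | no none = ⊥-elim (o∉X (connected X x₀∈X tt step tt))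
        where
        step : ∀ {a b} → a ∈ˢ X → ⊤ → ⊤ → a ~ b → b ∈ˢ X
        step {a} {b} a∈X _ _ a~b with b ∈ˢ? X
        ... | yes b∈X = b∈X
        ... | no b∉X = ⊥-elim (none (a , b , (a∈X , b∉X) , a~b))
      ... | yes (u , o₁ , (u∈X , o₁∉X) , u~o₁)
        with component-of (λ y → c y ≟ᶜ c u) {u} refl
      ... | U , compU , u∈U
        with any? (λ v → any? (λ y → ((v ∈ˢ? X) ×-dec ¬? (v ∈ˢ? U)) ×-dec (¬? (y ∈ˢ? X) ×-dec (v ~? y))))
      ... | no none = fill U u∈U (X⊆X₀ ∘ U⊆X) compU X U⊆X cX c∁X (o , o∉X)
              (λ x∈X x∉U y∉X x~y → none (_ , _ , (x∈X , x∉U) , y∉X , x~y)) smaller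
        where
        U⊆X : U ⊆ X
        U⊆X = conn compU X u∈X u∈U
          (λ a∈X a∈U b∈U → satX a∈X (trans (within compU a∈U) (sym (within compU b∈U))))
        smaller : ∀ D → D ⊆ X → Component (_∉ˢ U) D → Good D
        smaller D D⊆X compD = saturated-good X₀ fill D
          (rec (D⊆X , u , u∈X , λ u∈D → within compD u∈D u∈U))
          (X⊆X₀ ∘ D⊆X)
          -- An adjacency into `U` between equal colours would put its start into `U` as well, so
          -- `D` is again saturated.
          (λ {x} {y} x∈D eq x~y → closed compD x∈D
             (λ y∈U → within compD x∈D (closed compU y∈U (trans eq (within compU y∈U)) (~-sym x~y))) x~y)
          (conn compD)
          (component-complement (conn compU) (u , u∈U) compD)
          (nonempty compD) (o , λ o∈D → o∉X (D⊆X o∈D))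
      ... | yes (v , o₂ , (v∈X , v∉U) , o₂∉X , v~o₂)
        with component-of (λ z → (z ∈ˢ? X) ×-dec ¬? (z ∈ˢ? U)) {v} (v∈X , v∉U)
      ... | Z , compZ , v∈Z = branch Y Z Y⊆X Z⊆X
              split Y∉Z (u , u∈Y) (v , v∈Z) (o , o∉X) cY (conn compZ) c∁X t narrow
              (saturated-good X₀ fill Y (rec (Y⊆X , v , v∈X , λ v∈Y → Y∉Z v∈Y v∈Z))
                (X⊆X₀ ∘ Y⊆X) satY cY c∁Y (u , u∈Y) (o , o∉X ∘ Y⊆X))
              (saturated-good X₀ fill Z (rec (Z⊆X , u , u∈X , Y∉Z u∈Y))
                (X⊆X₀ ∘ Z⊆X) satZ (conn compZ) c∁Z (v , v∈Z) (o , o∉X ∘ Z⊆X))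
        where
        U⊆X : U ⊆ X
        U⊆X = conn compU X u∈X u∈U
          (λ a∈X a∈U b∈U → satX a∈X (trans (within compU a∈U) (sym (within compU b∈U))))
        Y? : Decidable (λ x → x ∈ˢ X × x ∉ˢ Z)
        Y? x = (x ∈ˢ? X) ×-dec ¬? (x ∈ˢ? Z)
        Y : Subset N
        Y = ⟪ Y? ⟫
        Y⊆X : Y ⊆ X
        Y⊆X = proj₁ ∘ ∈⟪⟫⁻ Y?
        Z⊆X : Z ⊆ X
        Z⊆X = proj₁ ∘ within compZ
        Y∉Z : ∀ {x} → x ∈ˢ Y → x ∉ˢ Z
        Y∉Z = proj₂ ∘ ∈⟪⟫⁻ Y?
        split : ∀ {x} → x ∈ˢ X → x ∈ˢ Y ⊎ x ∈ˢ Z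
        split {x} x∈X with x ∈ˢ? Z
        ... | yes x∈Z = inj₂ x∈Z
        ... | no x∉Z = inj₁ (∈⟪⟫⁺ Y? (x∈X , x∉Z))
        u∈Y : u ∈ˢ Y
        u∈Y = ∈⟪⟫⁺ Y? (u∈X , λ u∈Z → proj₂ (within compZ u∈Z) u∈U)
        satZ : Saturated Z
        satZ x∈Z eq x~y = closed compZ x∈Z
          ( satX (Z⊆X x∈Z) eq x~y
          , λ y∈U → proj₂ (within compZ x∈Z) (closed compU y∈U (trans eq (within compU y∈U)) (~-sym x~y)))
          x~y
        satY : Saturated Y
        satY x∈Y eq x~y = ∈⟪⟫⁺ Y? (satX (Y⊆X x∈Y) eq x~y , Sat-resp satZ (Y∉Z x∈Y) eq x~y)
        cY : Conn (_∈ˢ Y)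
        cY = Conn-resp (∈⟪⟫⁺ Y?) (∈⟪⟫⁻ Y?)
          (Conn-minus-component cX (conn compU) (u , u∈U) U⊆X compZ)
        notY : ∀ {x} → x ∉ˢ Y → x ∉ˢ X ⊎ x ∈ˢ Z
        notY {x} x∉Y with x ∈ˢ? X
        ... | no x∉X = inj₁ x∉X
        ... | yes x∈X with split x∈X
        ...   | inj₁ x∈Y = ⊥-elim (x∉Y x∈Y)
        ...   | inj₂ x∈Z = inj₂ x∈Z
        notZ : ∀ {x} → x ∉ˢ Z → x ∉ˢ X ⊎ x ∈ˢ Y
        notZ {x} x∉Z with x ∈ˢ? X
        ... | no x∉X = inj₁ x∉X
        ... | yes x∈X = inj₂ (∈⟪⟫⁺ Y? (x∈X , x∉Z))
        c∁Y : Conn (_∉ˢ Y)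
        c∁Y = Conn-union c∁X (conn compZ) (λ x∉X → x∉X ∘ Y⊆X) (λ x∈Z x∈Y → Y∉Z x∈Y x∈Z) notY
          o₂∉X v∈Z (~-sym v~o₂)
        c∁Z : Conn (_∉ˢ Z)
        c∁Z = Conn-union c∁X cY (λ x∉X → x∉X ∘ Z⊆X) Y∉Z notZ o₁∉X u∈Y (~-sym u~o₁)
        narrow : ∀ {x y} → x ~ y → ¬ SamePart X Y Z x y → Sep t x y
        -- `X`, `Y` and `Z` are all saturated, so adjacent hyperedges of equal colour are in the
        -- same part; those in different parts must differ in colour.
        narrow {x} {y} x~y diff = separates x~y (λ eq → diff (same eq))
          where
          same : c x ≡ c y → SamePart X Y Z x y
          same eq with x ∈ˢ? X
          ... | no x∉X = inj₂ (inj₂ (x∉X , Sat-resp satX x∉X eq x~y))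
          ... | yes x∈X with split x∈X
          ...   | inj₁ x∈Y = inj₁ (x∈Y , satY x∈Y eq x~y)
          ...   | inj₂ x∈Z = inj₂ (inj₁ (x∈Z , satZ x∈Z eq x~y))

    module _ {Colour : Set} (_≟ᶜ_ : DecidableEquality Colour) (c : Fin N → Colour) where

      -- Everything outside the component `C` is recoloured with the single colour `nothing`, which
      -- makes `X` saturated. The monochromatic components inside `C` are fillable by hypothesis.
      -- Those inside `X` but outside `C` are components of the complement of `C`, hence bonds, and
      -- are good by the premise of `Fillable`. So `saturated-good` applies.
      union-fillable :
        ∀ (A : Fin N → Set) t
        → (∀ {x y} → A x → c x ≡ c y → A y)
        → (∀ {x} → A x → AllFillable (λ y → c y ≡ c x))
        → (∀ {x y} → A x → x ~ y → c x ≢ c y → Sep t x y)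
        → AllFillable A
      union-fillable A t A-union fillA sepA C compC X C⊆X cX c∁X (o , o∉X) noadj goodD =
        saturated-good X fill X (⊂-wellFounded X) (λ x∈ → x∈) satX cX c∁X
          (let x , x∈C = nonempty compC in x , C⊆X x∈C) (o , o∉X)
        where
        c′ : Fin N → Maybe Colour
        c′ x with x ∈ˢ? C
        ... | yes _ = just (c x)
        ... | no _  = nothing
        c′-in : ∀ {x} → x ∈ˢ C → c′ x ≡ just (c x)
        c′-in {x} x∈C with x ∈ˢ? C
        ... | yes _ = refl
        ... | no x∉C = ⊥-elim (x∉C x∈C)
        c′-out : ∀ {x} → x ∉ˢ C → c′ x ≡ nothing
        c′-out {x} x∉C with x ∈ˢ? C
        ... | no _ = refl
        ... | yes x∈C = ⊥-elim (x∉C x∈C)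
        c′-in⁻ : ∀ {x k} → c′ x ≡ just k → x ∈ˢ C × c x ≡ k
        c′-in⁻ {x} eq with x ∈ˢ? C
        ... | yes x∈C = x∈C , just-injective eq
        c′-in⁻ () | no _
        c′-out⁻ : ∀ {x} → c′ x ≡ nothing → x ∉ˢ C
        c′-out⁻ {x} eq with x ∈ˢ? C
        ... | no x∉C = x∉C
        c′-out⁻ () | yes _
        separates′ : ∀ {x y} → x ~ y → c′ x ≢ c′ y → Sep t x y
        separates′ {x} {y} x~y ne with x ∈ˢ? C | y ∈ˢ? C
        ... | yes x∈C | yes _ = sepA (within compC x∈C) x~y (ne ∘ cong just)
        ... | yes x∈C | no y∉C = sepA (within compC x∈C) x~y
                (λ eq → y∉C (closed compC x∈C (A-union (within compC x∈C) eq) x~y))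
        ... | no x∉C | yes y∈C = Sep-sym (sepA (within compC y∈C) (~-sym x~y)
                (λ eq → x∉C (closed compC y∈C (A-union (within compC y∈C) eq) (~-sym x~y))))
        ... | no _ | no _ = ⊥-elim (ne refl)
        open Coloured (maybe-≡-dec _≟ᶜ_) c′ t separates′
        satX : Saturated X
        satX {x} {y} x∈X eq x~y with y ∈ˢ? X
        ... | yes y∈X = y∈X
        ... | no y∉X with x ∈ˢ? C
        ...   | yes x∈C = ⊥-elim (y∉X (C⊆X (proj₁ (c′-in⁻ (sym eq)))))
        ...   | no x∉C = ⊥-elim (noadj x∈X x∉C y∉X x~y)
        fill : ∀ U {u} → u ∈ˢ U → U ⊆ X → Component (λ y → c′ y ≡ c′ u) U → Fillable U
        fill U {u} u∈U U⊆X compU with u ∈ˢ? C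
        ... | yes u∈C = fillA (within compC u∈C) U record
                { within = proj₂ ∘ inside
                ; conn = conn compU
                ; nonempty = u , u∈U
                ; closed = λ z∈U cy z~y →
                    closed compU z∈U
                      (trans (c′-in (closed compC (proj₁ (inside z∈U))
                                      (A-union (within compC u∈C) (sym cy)) z~y))
                             (cong just cy))
                      z~y }
          where
          inside : ∀ {z} → z ∈ˢ U → z ∈ˢ C × c z ≡ c u
          inside z∈U = c′-in⁻ (within compU z∈U)
        ... | no u∉C = good-bond-fillable (goodD U U⊆X compU′)
                (component-complement (conn compC) (nonempty compC) compU′)
          where
          compU′ : Component (_∉ˢ C) U
          compU′ .within z∈U = c′-out⁻ (within compU z∈U)
          compU′ .conn = conn compU
          compU′ .nonempty = u , u∈U
          compU′ .closed z∈U y∉C z~y = closed compU z∈U (c′-out y∉C) z~y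

-- Lists that describe paths.

unique-init : {A : Set} (xs : List A) {ys : List A} → Unique (xs ++ ys) → Unique xs
unique-init [] _ = []
unique-init (x ∷ xs) (x∉ ∷ u) = All.++⁻ˡ xs x∉ ∷ unique-init xs u

linked-init : {A : Set} {R : A → A → Set} (xs : List A) {ys : List A} → Linked R (xs ++ ys) → Linked R xs
linked-init [] _ = []
linked-init (x ∷ []) _ = [-]
linked-init (x ∷ y ∷ xs) (r ∷ l) = r ∷ linked-init (y ∷ xs) l

last-map-suc : ∀ {m} (p : List (Fin m)) {z} → last p ≡ just z → last (map suc p) ≡ just (suc z)
last-map-suc (x ∷ []) refl = refl
last-map-suc (x ∷ y ∷ p) eq = last-map-suc (y ∷ p) eq

last-map-suc⁻ : ∀ {m} (p : List (Fin m)) {z} → last (map suc p) ≡ just z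
  → ∃[ z′ ] (z ≡ suc z′ × last p ≡ just z′)
last-map-suc⁻ (x ∷ []) refl = x , refl , refl
last-map-suc⁻ (x ∷ y ∷ p) eq = last-map-suc⁻ (y ∷ p) eq

last-∈ : {A : Set} (p : List A) {z : A} → last p ≡ just z → z ∈ p
last-∈ (x ∷ []) refl = here refl
last-∈ (x ∷ y ∷ p) eq = there (last-∈ (y ∷ p) eq)

last-snoc : {A : Set} (p : List A) {z : A} → last (p ++ z ∷ []) ≡ just z
last-snoc [] = refl
last-snoc (x ∷ []) = refl
last-snoc (x ∷ y ∷ p) = last-snoc (y ∷ p)

zero∉map-suc : ∀ {m} {p : List (Fin m)} → (Fin (suc m) ∋ zero) ∉ map Fin.suc p
zero∉map-suc z∈ with ∈-map⁻ Fin.suc z∈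
... | _ , _ , ()

-- Building up the nodes of a tree from a root.

module Spanning {m : ℕ} (T : Tree m) (ρ : Fin m) where
  open Tree T renaming (connected to path)
  open DecMembership (_≟_ {m}) using (_∈?_)

  -- The list records the order of attachment, latest first, so its head is always a leaf ready to
  -- be contracted into its parent `y`.
  data Subtree : List (Fin m) → Set where
    root : Subtree (ρ ∷ [])
    add  : ∀ {S y z} → Subtree S → y ∈ S → z ∉ S → Adj z y → Subtree (z ∷ S)

  crossing : ∀ S p {a x} → Linked Adj p → head p ≡ just a → last p ≡ just x → a ∈ S → x ∉ S
           → ∃[ y ] ∃[ z ] (y ∈ S × z ∉ S × Adj z y)
  crossing S (a ∷ []) [-] refl refl a∈S x∉S = ⊥-elim (x∉S a∈S)
  crossing S (a ∷ b ∷ p) (ab ∷ lp) refl lst a∈S x∉S with b ∈? S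
  ... | yes b∈S = crossing S (b ∷ p) lp refl lst b∈S x∉S
  ... | no b∉S = a , b , a∈S , b∉S , symm ab

  spanning : ∃[ S ] (Subtree S × (∀ x → x ∈ S))
  spanning = grow (ρ ∷ []) (⊃-wellFounded _) root (here refl)
    where
    grow : ∀ S → Acc _⊃_ ⟪ _∈? S ⟫ → Subtree S → ρ ∈ S → ∃[ S ] (Subtree S × (∀ x → x ∈ S))
    grow S (acc rec) G ρ∈S with any? (λ x → ¬? (x ∈? S))
    ... | no none = S , G , all
      where
      all : ∀ x → x ∈ S
      all x with x ∈? S
      ... | yes x∈S = x∈S
      ... | no x∉S = ⊥-elim (none (x , x∉S))
    ... | yes (x , x∉S) with path ρ x
    ... | p , hd , lst , lp , _ with crossing S p lp hd lst ρ∈S x∉S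
    ... | y , z , y∈S , z∉S , zy =
      grow (z ∷ S) (rec ((λ w∈ → ∈⟪⟫⁺ (_∈? (z ∷ S)) (there (∈⟪⟫⁻ (_∈? S) w∈)))
                        , z , ∈⟪⟫⁺ (_∈? (z ∷ S)) (here refl) , z∉S ∘ ∈⟪⟫⁻ (_∈? S)))
        (add G y∈S z∉S zy) (there ρ∈S)

  PathIn : List (Fin m) → Fin m → Fin m → Set
  PathIn S a b = ∃[ p ] (PathFrom a b p × All (_∈ S) p)

  prepend : ∀ {S y z b} → z ∉ S → Adj z y → PathIn S y b
    → ∃[ p ] (PathFrom z b (z ∷ p) × y ∈ p × All (_∈ S) p)
  prepend {S} {y} {z} z∉S zy ([] , (() , _) , _)
  prepend {S} {y} {z} z∉S zy (y ∷ p , (refl , lst , lp , up) , p⊆S) =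
    y ∷ p , (refl , lst , zy ∷ lp , All.map (λ w∈S z≡w → z∉S (subst (_∈ S) (sym z≡w) w∈S)) p⊆S ∷ up)
    , here refl , p⊆S

  append : ∀ {S y z a} → z ∉ S → Adj z y → PathIn S a y → PathIn (z ∷ S) a z
  append z∉S zy ([] , (() , _) , _)
  append {S} {y} {z} z∉S zy (a ∷ p , (refl , lst , lp , up) , p⊆S) =
    (a ∷ p) ++ z ∷ []
    , ( refl , last-snoc (a ∷ p)
      , Linked.++⁺ lp (subst (λ l → Connected.Connected Adj l (just z)) (sym lst) (Connected.just (symm zy))) [-]
      , Unique.++⁺ up ([] ∷ []) λ { (w∈p , here refl) → z∉S (All.lookup p⊆S w∈p) } )
    , All.tabulate λ w∈ →
        [ (λ w∈p → there (All.lookup p⊆S w∈p)) , (λ { (here w≡z) → here w≡z }) ]′ (∈-++⁻ (a ∷ p) w∈)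

  -- Keeping the path inside the subtree ensures that a node attached later can be added at either
  -- end without repetition.
  path-in : ∀ {S} → Subtree S → ∀ {a b} → a ∈ S → b ∈ S → PathIn S a b
  path-in {z ∷ _} _ (here refl) (here refl) = z ∷ [] , (refl , refl , [-] , [] ∷ []) , here refl ∷ []
  path-in (add G y∈S z∉S zy) (here refl) (there b∈S) =
    let p , pth , _ , p⊆S = prepend z∉S zy (path-in G y∈S b∈S)
    in _ ∷ p , pth , here refl ∷ All.map there p⊆S
  path-in (add G y∈S z∉S zy) (there a∈S) (here refl) = append z∉S zy (path-in G a∈S y∈S)
  path-in (add G y∈S z∉S zy) (there a∈S) (there b∈S) =
    let p , pth , p⊆S = path-in G a∈S b∈S in p , pth , All.map there p⊆S
  path-in root (there ()) _
  path-in root _ (there ())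

  -- A leaf is joined to the rest through its parent. This supplies the path along which the
  -- interpolation property of the decomposition is used.
  parent-on-path : ∀ {S y z s} → Subtree S → y ∈ S → z ∉ S → Adj z y → s ∈ S → OnPath z y s
  parent-on-path G y∈S z∉S zy s∈S =
    let p , pth , y∈p , _ = prepend z∉S zy (path-in G y∈S s∈S) in _ ∷ p , pth , there y∈p

-- Contracting the decomposition tree leaf by leaf.

module Peeling
  {N : ℕ} {_~_ : Fin N → Fin N → Set}
  (_~?_ : ∀ x y → Dec (x ~ y)) (~-sym : ∀ {x y} → x ~ y → y ~ x)
  (connected : Bonds.Conn _~?_ ~-sym (λ _ → ⊤))
  (connected-minus : ∀ e → Bonds.Conn _~?_ ~-sym (_≢ e))
  {m : ℕ} (T : Tree m) {V : Set} (_∈ᵉ_ : V → Fin N → Set) (_∈ᵇ_ : V → Fin m → Set)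
  (interpolate : ∀ x y z → Tree.OnPath T x y z → ∀ v → v ∈ᵇ x → v ∈ᵇ z → v ∈ᵇ y)
  (home : Fin N → Fin m) (home-covers : ∀ {v e} → v ∈ᵉ e → v ∈ᵇ home e)
  (e₀ : Fin N)
  where

  open Tree T using (Adj)
  open Spanning T (home e₀)
  open Bonds _~?_ ~-sym

  Sep : Fin m → Fin N → Fin N → Set
  Sep t x y = ∀ v → v ∈ᵉ x → v ∈ᵉ y → v ∈ᵇ t

  open Narrow connected {Sep = Sep} (λ sep v v∈y v∈x → sep v v∈x v∈y)

  Colour : Set
  Colour = Fin N ⊎ Fin m

  _≟ᶜ_ = sum-≡-dec (_≟_ {N}) (_≟_ {m})

  AllFillable-resp : {A B : Fin N → Set} → (∀ {x} → A x → B x) → (∀ {x} → B x → A x)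
                   → AllFillable A → AllFillable B
  AllFillable-resp f g fillA C compC = fillA C record
    { within = g ∘ within ; conn = conn ; nonempty = nonempty
    ; closed = λ x∈ Ay → closed x∈ (f Ay) }
    where open Component compC

  -- As no hyperedge is a cut-edge, the complement of `e` is connected and `e` alone is a bond,
  -- which makes it a good leaf.
  singleton-fillable : ∀ {A : Fin N → Set} e → (∀ {x} → A x → x ≡ e) → AllFillable A
  singleton-fillable e A⊆e C compC with Component.nonempty compC
  ... | y , y∈C = good-bond-fillable
          (leaf e e∈C (A⊆e ∘ Component.within compC))
          (Conn-resp (λ ne x∈C → ne (A⊆e (Component.within compC x∈C)))
                     (λ x∉C x≡e → x∉C (subst (_∈ˢ C) (sym x≡e) e∈C)) (connected-minus e))
    where
    e∈C : e ∈ˢ C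
    e∈C = subst (_∈ˢ C) (A⊆e (Component.within compC y∈C)) y∈C

  -- The tree with all nodes outside S contracted onto S: b x is the node at which the
  -- hyperedge x now lives, and c x is x itself or the last contracted node z
  -- whose branch contains x.
  record State (S : List (Fin m)) : Set where
    field
      b        : Fin N → Fin m
      c        : Fin N → Colour
      b∈S      : ∀ x → b x ∈ S
      c⇒b      : ∀ {x y} → c x ≡ c y → b x ≡ b y
      fillable : ∀ x → AllFillable (λ y → c y ≡ c x)
      separate : ∀ {x y} → c x ≢ c y → Sep (b x) x y
      fresh    : ∀ {x z} → c x ≡ inj₂ z → z ∉ S
      own      : ∀ {x y} → c x ≡ inj₁ y → x ≡ y
      c-root   : c e₀ ≡ inj₁ e₀
      b-root   : b e₀ ≡ home e₀

  initial : ∀ {S} → (∀ x → x ∈ S) → State S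
  initial all = record
    { b = home ; c = inj₁ ; b∈S = λ x → all (home x)
    ; c⇒b = λ eq → cong home (inj₁-injective eq)
    ; fillable = λ x → singleton-fillable x inj₁-injective
    ; separate = λ _ v v∈x _ → home-covers v∈x
    ; fresh = λ () ; own = inj₁-injective ; c-root = refl ; b-root = refl }

  root∈ : ∀ {S} → Subtree S → home e₀ ∈ S
  root∈ root = here refl
  root∈ (add G _ _ _) = there (root∈ G)

  -- The hyperedges living at the leaf `z` move to its parent `y` and become one class with the new
  -- colour `inj₂ z`. That class is fillable by `union-fillable`, with the bag of `z` as separator.
  -- A vertex shared by a moved hyperedge and an unmoved one lies in the bag of `z` and in the bag
  -- at which the unmoved one lives, hence by interpolation in the bag of `y`.
  contract : ∀ {S y z} → Subtree S → y ∈ S → z ∉ S → Adj z y → State (z ∷ S) → State S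
  contract {S} {y} {z} G y∈S z∉S zy st = record
    { b = b′ ; c = c′ ; b∈S = b′∈S ; c⇒b = c⇒b′ ; fillable = fillable′ ; separate = separate′
    ; fresh = fresh′ ; own = own′
    ; c-root = trans (proj₂ (stays e₀-stays)) c-root
    ; b-root = trans (proj₁ (stays e₀-stays)) b-root }
    where
    open State st
    b′ : Fin N → Fin m
    b′ x with b x ≟ z
    ... | yes _ = y
    ... | no _ = b x
    c′ : Fin N → Colour
    c′ x with b x ≟ z
    ... | yes _ = inj₂ z
    ... | no _ = c x
    moves : ∀ {x} → b x ≡ z → b′ x ≡ y × c′ x ≡ inj₂ z
    moves {x} bx with b x ≟ z
    ... | yes _ = refl , refl
    ... | no ne = ⊥-elim (ne bx)
    stays : ∀ {x} → b x ≢ z → b′ x ≡ b x × c′ x ≡ c x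
    stays {x} bx with b x ≟ z
    ... | yes eq = ⊥-elim (bx eq)
    ... | no _ = refl , refl
    e₀-stays : b e₀ ≢ z
    e₀-stays eq = z∉S (subst (_∈ S) (trans (sym b-root) eq) (root∈ G))
    not-fresh : ∀ {x} → c x ≢ inj₂ z
    -- The colour named after `z` has not been given out before, since colours of branches belong to
    -- nodes already removed.
    not-fresh eq = fresh eq (here refl)
    c′-new : ∀ {x} → c′ x ≡ inj₂ z → b x ≡ z
    c′-new {x} eq with b x ≟ z
    ... | yes bx = bx
    ... | no _ = ⊥-elim (not-fresh eq)
    b-old : ∀ x → b x ≢ z → b x ∈ S
    b-old x ne with b∈S x
    ... | here eq = ⊥-elim (ne eq)
    ... | there b∈ = b∈
    b′∈S : ∀ x → b′ x ∈ S
    b′∈S x with b x ≟ z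
    ... | yes _ = y∈S
    ... | no ne = b-old x ne
    c⇒b′ : ∀ {x w} → c′ x ≡ c′ w → b′ x ≡ b′ w
    c⇒b′ {x} {w} eq with b x ≟ z | b w ≟ z
    ... | yes _ | yes _ = refl
    ... | yes _ | no _ = ⊥-elim (not-fresh (sym eq))
    ... | no _ | yes _ = ⊥-elim (not-fresh eq)
    ... | no _ | no _ = c⇒b eq
    c′-old : ∀ {x w} → b x ≢ z → c w ≡ c x → c′ w ≡ c x
    c′-old bx eq = trans (proj₂ (stays (λ bw → bx (trans (sym (c⇒b eq)) bw)))) eq
    c′-old⁻ : ∀ {x w} → b x ≢ z → c′ w ≡ c x → c w ≡ c x
    c′-old⁻ {x} {w} bx eq with b w ≟ z
    ... | yes _ = ⊥-elim (not-fresh (sym eq))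
    ... | no _ = eq
    fillable′ : ∀ x → AllFillable (λ w → c′ w ≡ c′ x)
    fillable′ x with b x ≟ z
    ... | yes bx = AllFillable-resp (proj₂ ∘ moves) c′-new
            (union-fillable _≟ᶜ_ c (λ w → b w ≡ z) z
              (λ bu eq → trans (sym (c⇒b eq)) bu)
              (λ {u} _ → fillable u)
              (λ bu _ ne → subst (λ s → Sep s _ _) bu (separate ne)))
    ... | no bx = AllFillable-resp (c′-old bx) (c′-old⁻ bx) (fillable x)
    separate′ : ∀ {x w} → c′ x ≢ c′ w → Sep (b′ x) x w
    separate′ {x} {w} ne with b x ≟ z | b w ≟ z
    ... | yes _ | yes _ = ⊥-elim (ne refl)
    ... | yes bx | no bw = λ v v∈x v∈w →
            interpolate z y (b w) (parent-on-path G y∈S z∉S zy (b-old w bw)) v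
              (subst (v ∈ᵇ_) bx (separate (λ eq → bw (trans (sym (c⇒b eq)) bx)) v v∈x v∈w))
              (separate (λ eq → bw (trans (c⇒b eq) bx)) v v∈w v∈x)
    ... | no bx | yes bw = separate (λ eq → bx (trans (c⇒b eq) bw))
    ... | no _ | no _ = separate ne
    fresh′ : ∀ {x u} → c′ x ≡ inj₂ u → u ∉ S
    fresh′ {x} eq with b x ≟ z
    ... | yes _ = subst (_∉ S) (inj₂-injective eq) z∉S
    ... | no _ = fresh eq ∘ there
    own′ : ∀ {x u} → c′ x ≡ inj₁ u → x ≡ u
    own′ {x} eq with b x ≟ z
    own′ () | yes _
    ... | no _ = own eq

  contract-all : ∀ {S} → Subtree S → State S → State (home e₀ ∷ [])
  contract-all root st = st
  contract-all (add G y∈S z∉S zy) st = contract-all G (contract G y∈S z∉S zy st)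

  final-state : State (home e₀ ∷ [])
  final-state = let S , G , all = spanning in contract-all G (initial all)

  not-root? : ∀ x → Dec (x ≢ e₀)
  not-root? x = ¬? (x ≟ e₀)

  all-but-root : Subset N
  all-but-root = ⟪ not-root? ⟫

  -- Once all is contracted to the home of `e₀`, that hyperedge still has its private colour, so the
  -- other hyperedges form a saturated set. It is a bond because `e₀` is not a cut-edge.
  all-but-root-good : ∀ {e₁} → e₁ ≢ e₀ → Good all-but-root
  all-but-root-good {e₁} e₁≢e₀ =
    saturated-good X (λ U {u} _ _ compU → fillable u U compU) X (⊂-wellFounded X) (λ x∈ → x∈) satX
      (Conn-resp (∈⟪⟫⁺ X?) (∈⟪⟫⁻ X?) (connected-minus e₀))
      (λ W w∈ w∉X _ x∉X → subst (_∈ˢ W) (trans (only w∉X) (sym (only x∉X))) w∈)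
      (e₁ , ∈⟪⟫⁺ X? e₁≢e₀) (e₀ , λ e₀∈ → ∈⟪⟫⁻ X? e₀∈ refl)
    where
    X? = not-root?
    X = all-but-root
    open State final-state
    only : ∀ {x} → x ∉ˢ X → x ≡ e₀
    only {x} x∉X with x ≟ e₀
    ... | yes eq = eq
    ... | no ne = ⊥-elim (x∉X (∈⟪⟫⁺ X? ne))
    at-root : ∀ x → b x ≡ home e₀
    at-root x with b∈S x
    ... | here eq = eq
    open Coloured _≟ᶜ_ c (home e₀) (λ {x} _ ne → subst (λ t → Sep t _ _) (at-root x) (separate ne))
    satX : Saturated X
    satX x∈X eq _ = ∈⟪⟫⁺ X? λ { refl → ∈⟪⟫⁻ X? x∈X (own (trans eq c-root)) }

-- Comparing lengths of lists.

-- Each partner that is found is deleted from `ys`; injectivity of the relation keeps it from being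
-- needed by a later entry.
unique-image-≤ : {A B : Set} (R : A → B → Set) → ∀ {xs : List A} {ys : List B} → Unique xs
  → (∀ {x} → x ∈ xs → ∃[ y ] (y ∈ ys × R x y))
  → (∀ {x x′ y} → R x y → R x′ y → x ≡ x′)
  → length xs ≤ length ys
unique-image-≤ R {[]} _ _ _ = z≤n
unique-image-≤ R {x ∷ xs} (x∉ ∷ uniq) f inj with f (here refl)
... | y , y∈ , Rxy with ∈-∃++ y∈
... | ys₁ , ys₂ , refl = ≤-trans (s≤s (unique-image-≤ R uniq f′ inj)) (≤-reflexive len)
  where
  f′ : ∀ {x′} → x′ ∈ xs → ∃[ y′ ] (y′ ∈ ys₁ ++ ys₂ × R x′ y′)
  f′ x′∈ with f (there x′∈)
  ... | y′ , y′∈ , Rxy′ with ∈-++⁻ ys₁ y′∈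
  ...   | inj₁ y′∈₁ = y′ , ∈-++⁺ˡ y′∈₁ , Rxy′
  ...   | inj₂ (here refl) = ⊥-elim (All.lookup x∉ x′∈ (inj Rxy Rxy′))
  ...   | inj₂ (there y′∈₂) = y′ , ∈-++⁺ʳ ys₁ y′∈₂ , Rxy′
  len : suc (length (ys₁ ++ ys₂)) ≡ length (ys₁ ++ y ∷ ys₂)
  len = trans (cong suc (length-++ ys₁)) (trans (sym (+-suc _ _)) (sym (length-++ ys₁)))

unique-⊆-≤ : {A : Set} {xs ys : List A} → Unique xs → (∀ {x} → x ∈ xs → x ∈ ys) → length xs ≤ length ys
unique-⊆-≤ uniq sub = unique-image-≤ _≡_ uniq (λ x∈ → _ , sub x∈ , refl) (λ p q → trans p (sym q))

-- Components and ranks of finite graphs.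

module UnionFind {A : Set} (_≟ᴬ_ : DecidableEquality A) where

  -- The component map of the graph with edge list `L`, with one canonical node for each component.
  label : List (A × A) → A → A
  label [] x = x
  label ((u , v) ∷ L) x with label L x ≟ᴬ label L u
  ... | yes _ = label L v
  ... | no _  = label L x

  -- The rank of the edge list in the graphic matroid, that is the size of a spanning forest.
  rank : List (A × A) → ℕ
  rank [] = 0
  rank ((u , v) ∷ L) with label L u ≟ᴬ label L v
  ... | yes _ = rank L
  ... | no _  = suc (rank L)

  label-mono : ∀ q L {x y} → label L x ≡ label L y → label (q ∷ L) x ≡ label (q ∷ L) y
  label-mono (u , v) L {x} {y} eq with label L x ≟ᴬ label L u | label L y ≟ᴬ label L u
  ... | yes _ | yes _ = refl
  ... | yes p | no q = ⊥-elim (q (trans (sym eq) p))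
  ... | no p | yes q = ⊥-elim (p (trans eq q))
  ... | no _ | no _ = eq

  label-sound : ∀ L {u v} → (u , v) ∈ L → label L u ≡ label L v
  label-sound ((u , v) ∷ L) (here refl) with label L u ≟ᴬ label L u | label L v ≟ᴬ label L u
  ... | yes _ | yes _ = refl
  ... | yes _ | no _ = refl
  ... | no ne | _ = ⊥-elim (ne refl)
  label-sound (q ∷ L) (there e∈) = label-mono q L (label-sound L e∈)

  -- A node count is at most the rank plus the number of components. Removing an edge that merged
  -- two components adds one possible label, namely `label L u`, and lowers the rank by one.
  unique-≤-rank : ∀ L {xs cs} → Unique xs → (∀ {x} → x ∈ xs → label L x ∈ cs)
                → length xs ≤ rank L + length cs
  unique-≤-rank [] uniq f = unique-⊆-≤ uniq f
  unique-≤-rank ((u , v) ∷ L) {xs} {cs} uniq f with label L u ≟ᴬ label L v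
  ... | yes eq = unique-≤-rank L uniq f′
    where
    f′ : ∀ {x} → x ∈ xs → label L x ∈ cs
    f′ {x} x∈ with label L x ≟ᴬ label L u | f x∈
    ... | yes p | ∈cs = subst (_∈ cs) (trans (sym eq) (sym p)) ∈cs
    ... | no _ | ∈cs = ∈cs
  ... | no _ = ≤-trans (unique-≤-rank L uniq f′) (≤-reflexive (+-suc (rank L) (length cs)))
    where
    f′ : ∀ {x} → x ∈ xs → label L x ∈ label L u ∷ cs
    f′ {x} x∈ with label L x ≟ᴬ label L u | f x∈
    ... | yes p | _ = here p
    ... | no _ | ∈cs = there ∈cs

-- Parity sums under fixed-point-free involutions.

module Xor = CommutativeMonoidSum (CommutativeRing.+-commutativeMonoid xor-∧-commutativeRing)
open Xor using (sum; sum-cong-≗; sum-permute; ∑-distrib-+; sum-replicate-zero)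

module Parity {n : ℕ} (σ : Fin n → Fin n) (σσ : ∀ x → σ (σ x) ≡ x) (σ-free : ∀ x → σ x ≢ x) where

  σ-perm : Permutation n n
  σ-perm = permutation σ σ σσ σσ

  -- The orbits are pairs. Splitting each into its smaller and its larger element gives two half
  -- sums, and `σ` carries one onto the other.
  sum-invariant : ∀ (f : Fin n → Bool) → (∀ x → f (σ x) ≡ f x) → sum f ≡ false
  sum-invariant f inv = begin
    sum f                                    ≡⟨ sum-cong-≗ halves ⟩
    sum (λ x → up x xor down x)              ≡⟨ ∑-distrib-+ up down ⟩
    sum up xor sum down                      ≡⟨ cong (sum up xor_) (sum-permute down σ-perm) ⟩
    sum up xor sum (down ∘ σ)                ≡⟨ cong (sum up xor_) (sum-cong-≗ flip) ⟩
    sum up xor sum up                        ≡⟨ xor-same (sum up) ⟩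
    false                                    ∎
    where
    open ≡-Reasoning
    up down : Fin n → Bool
    up x = f x ∧ does (x <? σ x)
    down x = f x ∧ does (σ x <? x)
    flip : ∀ x → down (σ x) ≡ up x
    flip x = cong₂ _∧_ (inv x) (cong (λ y → does (y <? σ x)) (σσ x))
    halves : ∀ x → f x ≡ up x xor down x
    halves x with f x
    ... | false = refl
    ... | true with <-cmp x (σ x)
    ...   | tri< lt _ ngt = sym (cong₂ _xor_ (dec-true (x <? σ x) lt) (dec-false (σ x <? x) ngt))
    ...   | tri≈ _ eq _ = ⊥-elim (σ-free x (sym eq))
    ...   | tri> nlt _ gt = sym (cong₂ _xor_ (dec-false (x <? σ x) nlt) (dec-true (σ x <? x) gt))

  sum-indicator : ∀ {k} (p : Fin k) → sum (λ x → does (x ≟ p)) ≡ true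
  sum-indicator {suc k} zero = cong (true xor_) (sum-replicate-zero k)
  sum-indicator (suc p) = trans (sum-cong-≗ λ x → does-suc x p) (sum-indicator p)
    where
    does-suc : ∀ {k} (x p : Fin k) → does (suc x ≟ suc p) ≡ does (x ≟ p)
    does-suc x p with x ≟ p
    ... | yes _ = refl
    ... | no _ = refl

  -- Flipping `f` at `p` makes it invariant under `σ`, and the flip itself contributes the one.
  sum-odd : ∀ (f : Fin n → Bool) p → f p ≡ true → f (σ p) ≡ false
          → (∀ x → x ≢ p → x ≢ σ p → f (σ x) ≡ f x) → sum f ≡ true
  sum-odd f p fp fσp inv = begin
    sum f                                          ≡⟨ sum-cong-≗ split ⟩
    sum (λ x → does (x ≟ p) xor rest x)            ≡⟨ ∑-distrib-+ (λ x → does (x ≟ p)) rest ⟩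
    sum (λ x → does (x ≟ p)) xor sum rest          ≡⟨ cong₂ _xor_ (sum-indicator p)
                                                        (sum-invariant rest rest-inv) ⟩
    true                                           ∎
    where
    open ≡-Reasoning
    rest : Fin n → Bool
    rest x = does (x ≟ p) xor f x
    split : ∀ x → f x ≡ does (x ≟ p) xor rest x
    split x with does (x ≟ p) | f x
    ... | true | true = refl
    ... | true | false = refl
    ... | false | _ = refl
    rest-p : rest p ≡ false
    rest-p = trans (cong (_xor f p) (dec-true (p ≟ p) refl)) (cong (true xor_) fp)
    rest-σp : rest (σ p) ≡ false
    rest-σp = trans (cong (_xor f (σ p)) (dec-false (σ p ≟ p) (σ-free p))) fσp
    rest-inv : ∀ x → rest (σ x) ≡ rest x
    rest-inv x with x ≟ p | x ≟ σ p
    ... | yes refl | _ = trans rest-σp (sym (cong (true xor_) fp))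
    ... | no _ | yes refl = trans (trans (cong rest (σσ p)) rest-p) (sym fσp)
    ... | no ne | no ne′ = trans (cong (_xor f (σ x)) (dec-false (σ x ≟ p) λ eq →
        ne′ (trans (sym (σσ x)) (cong σ eq)))) (inv x ne ne′)

-- Finite quotients.

lookup-injective : {A : Set} {xs : List A} → Unique xs → ∀ {i j} → lookup xs i ≡ lookup xs j → i ≡ j
lookup-injective (_ ∷ _)  {zero}  {zero}  _  = refl
lookup-injective (x∉ ∷ _) {zero}  {suc j} eq = ⊥-elim (All.lookup x∉ (∈-lookup j) eq)
lookup-injective (x∉ ∷ _) {suc i} {zero}  eq = ⊥-elim (All.lookup x∉ (∈-lookup i) (sym eq))
lookup-injective (_ ∷ u)  {suc i} {suc j} eq = cong suc (lookup-injective u eq)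

-- The quotient is presented by numbers in `Fin c`, so that being in the same class becomes a
-- decidable equality.
record Classes {n : ℕ} (R : Fin n → Fin n → Set) (c : ℕ) : Set where
  field
    class       : Fin n → Fin c
    rep         : Fin c → Fin n
    class⇒      : ∀ {x y} → class x ≡ class y → R x y
    ⇒class      : ∀ {x y} → R x y → class x ≡ class y
    class-rep   : ∀ i → class (rep i) ≡ i

classes : ∀ {n c} {S : Fin n → Fin n → Set} → NumClasses n (EqClosure S) c → Classes (EqClosure S) c
classes {S = S} (reps , refl , unique , separated , covered) = record
  { class = class ; rep = lookup reps
  ; class⇒ = λ {x} {y} eq → R-rep x ◅◅ subst (λ i → R (lookup reps i) y) (sym eq) (symmetric S (R-rep y))
  ; ⇒class = ⇒class
  ; class-rep = λ i → lookup-injective unique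
      (sym (separated (∈-lookup i) (∈-lookup _) (R-rep (lookup reps i)))) }
  where
  R = EqClosure S
  class : ∀ x → Fin (length reps)
  class x = let _ , r∈ , _ = covered x in Any.index r∈
  R-rep : ∀ x → R x (lookup reps (class x))
  R-rep x = let _ , r∈ , Rxr = covered x in subst (R x) (lookup-index r∈) Rxr
  ⇒class : ∀ {x y} → R x y → class x ≡ class y
  ⇒class {x} {y} Rxy = lookup-injective unique
    (separated (∈-lookup _) (∈-lookup _) (symmetric S (R-rep x) ◅◅ Rxy ◅◅ R-rep y))

closure-induction : ∀ {n} {S : Fin n → Fin n → Set} (P : Fin n → Set)
  → (∀ {x y} → S x y → P x → P y) → (∀ {x y} → S x y → P y → P x)
  → ∀ {x y} → EqClosure S x y → P x → P y
closure-induction P f g ε px = px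
closure-induction P f g (fwd s ◅ path) px = closure-induction P f g path (f s px)
closure-induction P f g (bwd s ◅ path) px = closure-induction P f g path (g s px)

-- Hyperedges, vertices and faces in terms of flags.

module Surface (H : SurfaceHypergraph) {nN nF : ℕ}
  (nodes : Classes (SurfaceHypergraph.SameNode H) nN)
  (faces : Classes (SurfaceHypergraph.SameFace H) nF) where

  open SurfaceHypergraph H hiding (map; EulerGenus; AtLeastTwoHyperedges; Pending; CutEdge)

  open Classes nodes public renaming
    (class to node; rep to node-rep; class⇒ to node⇒; ⇒class to ⇒node; class-rep to node-node-rep)
  open Classes faces public renaming
    (class to face; rep to face-rep; class⇒ to face⇒; ⇒class to ⇒face; class-rep to face-face-rep)

  face-a0 : ∀ x → face (a0 x) ≡ face x
  face-a0 x = ⇒face (bwd (inj₁ refl) ◅ ε)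

  face-a1 : ∀ x → face (a1 x) ≡ face x
  face-a1 x = ⇒face (bwd (inj₂ refl) ◅ ε)

  node-a1 : ∀ x → node (a1 x) ≡ node x
  node-a1 x = ⇒node (bwd (inj₁ refl) ◅ ε)

  node-a2 : ∀ x → node (a2 x) ≡ node x
  node-a2 x = ⇒node (bwd (inj₂ refl) ◅ ε)

  col-flip : ∀ x → col (a0 x) ≡ not (col x)
  col-flip x = ¬-not (col-a0 x)

  a0a2 : ∀ x → a0 (a2 x) ≡ a2 (a0 x)
  a0a2 x = trans (sym (a2-inv _)) (cong a2
    (trans (sym (a0-inv _)) (cong a0 (a02-inv x))))

  -- Each flag lies on a unique edge, with one end in V_E and one end in V.
  centre : Fin n → Fin n
  centre x with col x
  ... | true = x
  ... | false = a0 x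

  end : Fin n → Fin n
  end x with col x
  ... | true = a0 x
  ... | false = x

  centre-cases : ∀ x → centre x ≡ x ⊎ centre x ≡ a0 x
  centre-cases x with col x
  ... | true = inj₁ refl
  ... | false = inj₂ refl

  centre-true : ∀ {x} → col x ≡ true → centre x ≡ x
  centre-true {x} eq with col x
  centre-true refl | true = refl

  centre-false : ∀ {x} → col x ≡ false → centre x ≡ a0 x
  centre-false {x} eq with col x
  centre-false refl | false = refl

  end-true : ∀ {x} → col x ≡ true → end x ≡ a0 x
  end-true {x} eq with col x
  end-true refl | true = refl

  end-false : ∀ {x} → col x ≡ false → end x ≡ x
  end-false {x} eq with col x
  end-false refl | false = refl

  col-centre : ∀ x → col (centre x) ≡ true
  col-centre x with col x in eq
  ... | true = eq
  ... | false = trans (col-flip x) (cong not eq)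

  centre-a0 : ∀ x → centre (a0 x) ≡ centre x
  centre-a0 x with col x in eq
  ... | true = trans (centre-false (trans (col-flip x) (cong not eq))) (a0-inv x)
  ... | false = centre-true (trans (col-flip x) (cong not eq))

  end-a0 : ∀ x → end (a0 x) ≡ end x
  end-a0 x with col x in eq
  ... | true = end-false (trans (col-flip x) (cong not eq))
  ... | false = trans (end-true (trans (col-flip x) (cong not eq))) (a0-inv x)

  centre-a2 : ∀ x → centre (a2 x) ≡ a2 (centre x)
  centre-a2 x with col x in eq
  ... | true = centre-true (trans (col-a2 x) eq)
  ... | false = trans (centre-false (trans (col-a2 x) eq)) (a0a2 x)

  end-a2 : ∀ x → end (a2 x) ≡ a2 (end x)
  end-a2 x with col x in eq
  ... | true = trans (end-true (trans (col-a2 x) eq)) (a0a2 x)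
  ... | false = end-false (trans (col-a2 x) eq)

  face-centre : ∀ x → face (centre x) ≡ face x
  face-centre x with col x
  ... | true = refl
  ... | false = face-a0 x

  col-node : ∀ {x y} → SameNode x y → col x ≡ col y
  col-node {x} {y} p = closure-induction (λ z → col x ≡ col z) f g p refl
    where
    f : ∀ {z w} → Step12 z w → col x ≡ col z → col x ≡ col w
    f (inj₁ refl) eq = trans eq (sym (col-a1 _))
    f (inj₂ refl) eq = trans eq (sym (col-a2 _))
    g : ∀ {z w} → Step12 z w → col x ≡ col w → col x ≡ col z
    g (inj₁ refl) eq = trans eq (col-a1 _)
    g (inj₂ refl) eq = trans eq (col-a2 _)

  is-hyperedge? : ∀ i → Dec (col (node-rep i) ≡ true)
  is-hyperedge? i = col (node-rep i) ≟ᵇ true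

  hyperedges : List (Fin nN)
  hyperedges = filter is-hyperedge? (allFin nN)

  hyperedges-unique : Unique hyperedges
  hyperedges-unique = Unique.filter⁺ is-hyperedge? (Unique.allFin⁺ nN)

  h : ℕ
  h = length hyperedges

  centre∈ : ∀ x → node (centre x) ∈ hyperedges
  centre∈ x = ∈-filter⁺ is-hyperedge? (∈-allFin _)
    (trans (col-node (node⇒ (node-node-rep (node (centre x))))) (col-centre x))

  opaque
    hyp : Fin n → Fin h
    hyp x = Any.index (centre∈ x)

    lookup-hyp : ∀ x → lookup hyperedges (hyp x) ≡ node (centre x)
    lookup-hyp x = sym (lookup-index (centre∈ x))

  ⇒hyp : ∀ {x y} → node (centre x) ≡ node (centre y) → hyp x ≡ hyp y
  ⇒hyp {x} {y} eq = lookup-injective hyperedges-unique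
    (trans (lookup-hyp x) (trans eq (sym (lookup-hyp y))))

  hyp⇒ : ∀ {x y} → hyp x ≡ hyp y → SameNode (centre x) (centre y)
  hyp⇒ {x} {y} eq = node⇒ (trans (sym (lookup-hyp x)) (trans (cong (lookup hyperedges) eq) (lookup-hyp y)))

  hyp-rep : Fin h → Fin n
  hyp-rep e = node-rep (lookup hyperedges e)

  col-hyp-rep : ∀ e → col (hyp-rep e) ≡ true
  col-hyp-rep e = proj₂ (∈-filter⁻ is-hyperedge? {xs = allFin nN} (∈-lookup {xs = hyperedges} e))

  hyp-hyp-rep : ∀ e → hyp (hyp-rep e) ≡ e
  hyp-hyp-rep e = lookup-injective hyperedges-unique
    (trans (lookup-hyp _) (trans (cong node (centre-true (col-hyp-rep e))) (node-node-rep _)))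

  hyp-a0 : ∀ x → hyp (a0 x) ≡ hyp x
  hyp-a0 x = ⇒hyp (cong node (centre-a0 x))

  hyp-a2 : ∀ x → hyp (a2 x) ≡ hyp x
  hyp-a2 x = ⇒hyp (trans (cong node (centre-a2 x)) (node-a2 _))

  hyp-a1 : ∀ {x} → col x ≡ true → hyp (a1 x) ≡ hyp x
  hyp-a1 {x} eq = ⇒hyp (trans (cong node (centre-true (trans (col-a1 x) eq)))
    (trans (node-a1 x) (cong node (sym (centre-true eq)))))

  hyp-centre : ∀ x → hyp (centre x) ≡ hyp x
  hyp-centre x = ⇒hyp (cong node (centre-true (col-centre x)))

  opaque
    vert : Fin n → Fin nN
    vert x = node (end x)

    vert-end : ∀ x → vert x ≡ node (end x)
    vert-end x = refl

  vert-a0 : ∀ x → vert (a0 x) ≡ vert x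
  vert-a0 x = trans (vert-end _) (trans (cong node (end-a0 x)) (sym (vert-end x)))

  vert-a2 : ∀ x → vert (a2 x) ≡ vert x
  vert-a2 x = trans (vert-end _) (trans (cong node (end-a2 x)) (trans (node-a2 _) (sym (vert-end x))))

  vert-a1 : ∀ {x} → col x ≡ false → vert (a1 x) ≡ vert x
  vert-a1 {x} eq = trans (vert-end _) (trans (cong node (end-false (trans (col-a1 x) eq)))
    (trans (node-a1 x) (trans (cong node (sym (end-false eq))) (sym (vert-end x)))))

  flag-induction : (P : Fin n → Set) → (∀ {x} → P x → P (a0 x)) → (∀ {x} → P x → P (a1 x))
    → (∀ {x} → P x → P (a2 x)) → ∀ {x} → P x → ∀ y → P y
  flag-induction P p0 p1 p2 {x} px y = closure-induction P f g (connected x y) px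
    where
    f : ∀ {z w} → Step012 z w → P z → P w
    f (inj₁ refl) = p0
    f (inj₂ (inj₁ refl)) = p1
    f (inj₂ (inj₂ refl)) = p2
    g : ∀ {z w} → Step012 z w → P w → P z
    g (inj₁ refl) pw = subst P (a0-inv _) (p0 pw)
    g (inj₂ (inj₁ refl)) pw = subst P (a1-inv _) (p1 pw)
    g (inj₂ (inj₂ refl)) pw = subst P (a2-inv _) (p2 pw)

  _~_ : Fin h → Fin h → Set
  e ~ e′ = ∃[ x ] ∃[ y ] (hyp x ≡ e × hyp y ≡ e′ × face x ≡ face y)

  _~?_ : ∀ e e′ → Dec (e ~ e′)
  e ~? e′ = any? λ x → any? λ y → (hyp x ≟ e) ×-dec ((hyp y ≟ e′) ×-dec (face x ≟ face y))

  ~-sym : ∀ {e e′} → e ~ e′ → e′ ~ e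
  ~-sym (x , y , p , q , r) = y , x , q , p , sym r

  open Bonds _~?_ ~-sym public

  share-face : ∀ {x y} → face x ≡ face y → hyp x ~ hyp y
  share-face eq = _ , _ , refl , refl , eq

  -- Walk from flag to flag: `a0` and `a2` keep the hyperedge and `a1` keeps the face, so each move
  -- stays put or goes to an adjacent hyperedge.
  hyperedges-connected : Conn (λ _ → ⊤)
  hyperedges-connected W {w} w∈W _ closed {x} _ =
    subst (_∈ˢ W) (hyp-hyp-rep x)
      (flag-induction (λ z → hyp z ∈ˢ W) (subst (_∈ˢ W) (sym (hyp-a0 _)))
        (λ {z} z∈ → closed z∈ tt tt (share-face (sym (face-a1 z))))
        (subst (_∈ˢ W) (sym (hyp-a2 _)))
        (subst (_∈ˢ W) (sym (hyp-hyp-rep w)) w∈W) (hyp-rep x))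

  -- A set `W` separating the hyperedges other than `e` would separate the surface cut along `e`.
  -- The invariant is `Reached`: the face of the flag touches a hyperedge of `W` other than `e`. It
  -- survives every cut step in both directions, yet fails at the flag of `x`.
  hyperedges-connected-minus : (∀ e → ¬ CutEdge H e) → ∀ e → Conn (_≢ e)
  hyperedges-connected-minus no-cut e W {w} w∈W w≢e closed {x} x≢e with x ∈ˢ? W
  ... | yes x∈W = x∈W
  ... | no x∉W = ⊥-elim (no-cut ê
        (col-hyp-rep e , hyp-rep w , hyp-rep x , outside w≢e , outside x≢e , unreachable))
    where
    ê = hyp-rep e
    in-hyp : ∀ {z} → SameNode ê z → hyp z ≡ e
    in-hyp {z} p = trans (⇒hyp (cong-centre)) (hyp-hyp-rep e)
      where
      cong-centre : node (centre z) ≡ node (centre ê)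
      cong-centre = trans (cong node (centre-true (trans (sym (col-node p)) (col-hyp-rep e))))
        (trans (sym (⇒node p)) (cong node (sym (centre-true (col-hyp-rep e)))))
    EdgeIn⇒ : ∀ {z} → EdgeIn ê z → hyp z ≡ e
    EdgeIn⇒ (inj₁ p) = in-hyp p
    EdgeIn⇒ (inj₂ p) = trans (sym (hyp-a0 _)) (in-hyp p)
    ⇒EdgeIn′ : ∀ {z y} → centre z ≡ y → SameNode (centre z) (centre ê) → SameNode ê y
    ⇒EdgeIn′ refl p = subst (λ y → SameNode y _) (centre-true (col-hyp-rep e)) (symmetric Step12 p)
    ⇒EdgeIn : ∀ {z} → hyp z ≡ e → EdgeIn ê z
    ⇒EdgeIn {z} eq with hyp⇒ {z} {ê} (trans eq (sym (hyp-hyp-rep e)))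
    ... | p with centre-cases z
    ...   | inj₁ cz = inj₁ (⇒EdgeIn′ cz p)
    ...   | inj₂ cz = inj₂ (⇒EdgeIn′ cz p)
    outside : ∀ {y} → y ≢ e → ¬ EdgeIn ê (hyp-rep y)
    outside y≢e p = y≢e (trans (sym (hyp-hyp-rep _)) (EdgeIn⇒ p))
    Reached : Fin n → Set
    Reached z = ∃[ y ] (face y ≡ face z × hyp y ∈ˢ W × hyp y ≢ e)
    across : ∀ {z} → ¬ EdgeIn ê z → Reached z → hyp z ∈ˢ W
    across ne (y , fy , y∈W , y≢e) = closed y∈W y≢e (ne ∘ ⇒EdgeIn) (share-face fy)
    reached-a2 : ∀ {z} → ¬ EdgeIn ê z → Reached z → Reached (a2 z)
    reached-a2 {z} ne r = a2 z , refl , subst (_∈ˢ W) (sym (hyp-a2 z)) (across ne r)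
      , λ eq → ne (⇒EdgeIn (trans (sym (hyp-a2 z)) eq))
    reached-a2⁻ : ∀ {z} → ¬ EdgeIn ê z → Reached (a2 z) → Reached z
    reached-a2⁻ {z} ne (y , fy , y∈W , y≢e) = z , refl
      , subst (_∈ˢ W) (hyp-a2 z) (closed y∈W y≢e
          (λ eq → ne (⇒EdgeIn (trans (sym (hyp-a2 z)) eq))) (share-face fy))
      , ne ∘ ⇒EdgeIn
    unreachable : ¬ EqClosure (CutStep ê) (hyp-rep w) (hyp-rep x)
    unreachable path = x∉W (subst (_∈ˢ W) (hyp-hyp-rep x) (across (outside x≢e)
      (closure-induction Reached f g path
        (hyp-rep w , refl , subst (_∈ˢ W) (sym (hyp-hyp-rep w)) w∈W
        , λ eq → w≢e (trans (sym (hyp-hyp-rep w)) eq)))))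
      where
      f : ∀ {z y} → CutStep ê z y → Reached z → Reached y
      f {z} (inj₁ refl) (u , fu , r) = u , trans fu (sym (face-a0 z)) , r
      f {z} (inj₂ (inj₁ refl)) (u , fu , r) = u , trans fu (sym (face-a1 z)) , r
      f (inj₂ (inj₂ (refl , ne))) = reached-a2 ne
      g : ∀ {z y} → CutStep ê z y → Reached y → Reached z
      g {z} (inj₁ refl) (u , fu , r) = u , trans fu (face-a0 z) , r
      g {z} (inj₂ (inj₁ refl)) (u , fu , r) = u , trans fu (face-a1 z) , r
      g (inj₂ (inj₂ (refl , ne))) = reached-a2⁻ ne

-- Euler's formula and the number of border faces.

length-allFin : ∀ n → length (allFin n) ≡ n
length-allFin n = length-tabulate (λ (i : Fin n) → i)

∧-guard : ∀ {a b b′} → (a ≡ true → b ≡ b′) → a ∧ b ≡ a ∧ b′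
∧-guard {true} f = f refl
∧-guard {false} _ = refl

∧∧-guard : ∀ {a a′ b b′ c c′} → a ≡ a′ → (a′ ≡ true → b ∧ c ≡ b′ ∧ c′) → (a ∧ b) ∧ c ≡ (a′ ∧ b′) ∧ c′
∧∧-guard {true} refl f = f refl
∧∧-guard {false} refl _ = refl

module Counting (H : SurfaceHypergraph) {nN nF nE : ℕ}
  (nodes : Classes (SurfaceHypergraph.SameNode H) nN)
  (faces : Classes (SurfaceHypergraph.SameFace H) nF)
  (edges : Classes (SurfaceHypergraph.SameEdge H) nE) where

  open SurfaceHypergraph H hiding (map; EulerGenus; AtLeastTwoHyperedges; Pending; CutEdge)

  open Surface H nodes faces
  open Classes edges using () renaming
    (class to edge; rep to edge-rep; class⇒ to edge⇒; class-rep to edge-edge-rep)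

  corner? : ∀ g → Dec (_ × _)
  corner? g = (col g ≟ᵇ true) ×-dec (g <? a1 g)

  -- One flag g for every corner (a centre flag up to a1), that is for every incidence between
  -- a hyperedge and a face.
  corners : List (Fin n)
  corners = filter corner? (allFin n)

  corners-centre : ∀ {g} → g ∈ corners → col g ≡ true
  corners-centre g∈ = proj₁ (proj₂ (∈-filter⁻ corner? {xs = allFin n} g∈))

  corners-cover : ∀ g → col g ≡ true → g ∈ corners ⊎ a1 g ∈ corners
  corners-cover g eq with <-cmp g (a1 g)
  ... | tri< lt _ _ = inj₁ (∈-filter⁺ corner? (∈-allFin g) (eq , lt))
  ... | tri≈ _ e _ = ⊥-elim (a1-free g (sym e))
  ... | tri> _ _ gt = inj₂ (∈-filter⁺ corner? (∈-allFin (a1 g))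
          (trans (col-a1 g) eq , subst (a1 g <_) (sym (a1-inv g)) gt))

  -- Count the flags at centres: a corner accounts for two of them, `g` and `a1 g`, and an edge for
  -- two, `mid i` and `a2 (mid i)`.
  corners-≤-edges : length corners ≤ nE
  corners-≤-edges = *-cancelˡ-≤ 2 (begin
    2 * length corners                                             ≡⟨ double corners (map a1 corners) (length-map a1 corners) ⟨
    length (corners ++ map a1 corners)                             ≤⟨ unique-⊆-≤ uniq sub ⟩
    length (map mid (allFin nE) ++ map (a2 ∘ mid) (allFin nE))     ≡⟨ double (map mid (allFin nE)) _
      (trans (length-map (a2 ∘ mid) (allFin nE)) (sym (length-map mid (allFin nE)))) ⟩
    2 * length (map mid (allFin nE))                               ≡⟨ cong (2 *_)
      (trans (length-map mid (allFin nE)) (length-allFin nE)) ⟩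
    2 * nE                                                         ∎)
    where
    open ≤-Reasoning
    double : ∀ {A : Set} (xs ys : List A) → length ys ≡ length xs → length (xs ++ ys) ≡ 2 * length xs
    double xs ys eq = trans (length-++ xs) (cong (length xs +_) (trans eq (sym (+-identityʳ _))))
    mid : Fin nE → Fin n
    mid i = centre (edge-rep i)
    mids : List (Fin n)
    mids = map mid (allFin nE) ++ map (a2 ∘ mid) (allFin nE)
    a1-injective : ∀ {x y} → a1 x ≡ a1 y → x ≡ y
    a1-injective eq = trans (sym (a1-inv _)) (trans (cong a1 eq) (a1-inv _))
    uniq : Unique (corners ++ map a1 corners)
    uniq = Unique.++⁺ corners-unique (Unique.map⁺ a1-injective corners-unique) disjoint
      where
      corners-unique : Unique corners
      corners-unique = Unique.filter⁺ corner? (Unique.allFin⁺ n)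
      disjoint : ∀ {x} → ¬ (x ∈ corners × x ∈ map a1 corners)
      disjoint (x∈ , x∈′) with ∈-map⁻ a1 x∈′
      ... | y , y∈ , refl with <-cmp y (a1 y)
                             | proj₂ (proj₂ (∈-filter⁻ corner? {xs = allFin n} x∈))
                             | proj₂ (proj₂ (∈-filter⁻ corner? {xs = allFin n} y∈))
      ...   | tri< _ _ ngt | gt | _ = ngt (subst (a1 y <_) (a1-inv y) gt)
      ...   | tri≈ nlt _ _ | _ | lt = nlt lt
      ...   | tri> nlt _ _ | _ | lt = nlt lt
    same-edge : ∀ {x y} → SameEdge x y → centre y ≡ centre x ⊎ centre y ≡ a2 (centre x)
    same-edge {x} path = closure-induction P f g path (inj₁ refl)
      where
      P : Fin n → Set
      P z = centre z ≡ centre x ⊎ centre z ≡ a2 (centre x)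
      step2 : ∀ {z} → P z → P (a2 z)
      step2 {z} (inj₁ eq) = inj₂ (trans (centre-a2 z) (cong a2 eq))
      step2 {z} (inj₂ eq) = inj₁ (trans (centre-a2 z) (trans (cong a2 eq) (a2-inv _)))
      f : ∀ {z w} → Step02 z w → P z → P w
      f (inj₁ refl) = subst (λ c → c ≡ centre x ⊎ c ≡ a2 (centre x)) (sym (centre-a0 _))
      f (inj₂ refl) = step2
      g : ∀ {z w} → Step02 z w → P w → P z
      g (inj₁ refl) = subst (λ c → c ≡ centre x ⊎ c ≡ a2 (centre x)) (centre-a0 _)
      g (inj₂ refl) p = subst P (a2-inv _) (step2 p)
    covered : ∀ {x} → col x ≡ true → x ∈ mids
    covered {x} eq with same-edge (edge⇒ {edge-rep (edge x)} {x} (edge-edge-rep (edge x)))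
    ... | inj₁ e = subst (_∈ mids) (trans (sym e) (centre-true eq)) (∈-++⁺ˡ (∈-map⁺ mid (∈-allFin (edge x))))
    ... | inj₂ e = subst (_∈ mids) (trans (sym e) (centre-true eq))
            (∈-++⁺ʳ (map mid (allFin nE)) (∈-map⁺ (a2 ∘ mid) (∈-allFin (edge x))))
    sub : ∀ {x} → x ∈ corners ++ map a1 corners → x ∈ mids
    sub x∈ with ∈-++⁻ corners x∈
    ... | inj₁ x∈₁ = covered (corners-centre x∈₁)
    ... | inj₂ x∈₂ with ∈-map⁻ a1 x∈₂
    ...   | y , y∈ , refl = covered (trans (col-a1 y) (corners-centre y∈))

  -- Three colours and the two graphs on the corners.

  module Colouring (κ : Fin h → Fin 3) where

    kind : Fin n → Fin 3
    kind x = κ (hyp x)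

    Border : Fin nN → Set
    Border v = ∃[ x ] ∃[ y ] (vert x ≡ v × vert y ≡ v × kind x ≢ kind y)

    border? : ∀ v → Dec (Border v)
    border? v = any? λ x → any? λ y → (vert x ≟ v) ×-dec ((vert y ≟ v) ×-dec ¬? (kind x ≟ kind y))

    -- Comparing with one representative is enough, since two flags of different colours cannot both
    -- agree with it.
    Mixed : Fin nF → Set
    Mixed f = ∃[ x ] (face x ≡ f × kind x ≢ kind (face-rep f))

    mixed? : ∀ f → Dec (Mixed f)
    mixed? f = any? λ x → (face x ≟ f) ×-dec ¬? (kind x ≟ kind (face-rep f))

    -- The incidence graph of hyperedges and faces, where each face is split into one copy for
    -- each colour, and the graph of vertices with all border vertices merged into
    -- the single node nothing.  The corners are the edges of both graphs.
    Split Merged : Set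
    Split = Fin h ⊎ (Fin nF × Fin 3)
    Merged = Maybe (Fin nN)

    _≟ˢ_ : DecidableEquality Split
    _≟ˢ_ = sum-≡-dec _≟_ (Product.≡-dec _≟_ _≟_)

    _≟ᵐ_ : DecidableEquality Merged
    _≟ᵐ_ = maybe-≡-dec _≟_

    merge : Fin nN → Merged
    merge v with border? v
    ... | yes _ = nothing
    ... | no _ = just v

    merge-border : ∀ {v} → Border v → merge v ≡ nothing
    merge-border {v} b with border? v
    ... | yes _ = refl
    ... | no nb = ⊥-elim (nb b)

    merge-inner : ∀ {v} → ¬ Border v → merge v ≡ just v
    merge-inner {v} nb with border? v
    ... | yes b = ⊥-elim (nb b)
    ... | no _ = refl

    split-edge : Fin n → Split × Split
    split-edge g = inj₁ (hyp g) , inj₂ (face g , kind g)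

    -- A corner lies between two consecutive edges around a centre, and the ends of these are
    -- joined. This crosses the edge from the hyperedge to the face, so the two graphs relate like
    -- an edge set and its dual.
    merged-edge : Fin n → Merged × Merged
    merged-edge g = merge (vert g) , merge (vert (a1 g))

    module UFˢ = UnionFind _≟ˢ_
    module UFᵐ = UnionFind _≟ᵐ_

    -- A parity count over the flags: the boundary of an inner vertex is a closed walk in the
    -- split graph, so it crosses every cut of that graph an even number of times.
    no-odd-corner :
      ∀ (ℓᵐ : Merged → Merged) (ℓˢ : Split → Split) p → col p ≡ true
      → (∀ g → col g ≡ true → g ≢ p → g ≢ a1 p →
           ℓᵐ (merge (vert g)) ≡ ℓᵐ (merge (vert (a1 g)))
           ⊎ ℓˢ (inj₁ (hyp g)) ≡ ℓˢ (inj₂ (face g , kind g)))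
      → ℓᵐ (merge (vert p)) ≢ ℓᵐ (merge (vert (a1 p)))
      → ℓˢ (inj₁ (hyp p)) ≢ ℓˢ (inj₂ (face p , kind p))
      → ℓᵐ (merge (vert p)) ≢ ℓᵐ nothing
      → ⊥
    no-odd-corner ℓᵐ ℓˢ p colp others mne sne pne = absurd (trans (sym odd) even)
      where
      absurd : ¬ (true ≡ false)
      absurd ()
      -- `inside` marks the merged component of the vertex of `p`, and `total` the flags at centres
      -- over it whose split edge leaves the class of `hyp p`. The sum of `total` is computed twice,
      -- with different parities.
      inside first second at-hyp at-face : Fin n → Bool
      inside x = does (ℓᵐ (merge (vert x)) ≟ᵐ ℓᵐ (merge (vert p)))
      at-hyp x = does (ℓˢ (inj₁ (hyp x)) ≟ˢ ℓˢ (inj₁ (hyp p)))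
      at-face x = does (ℓˢ (inj₂ (face x , kind x)) ≟ˢ ℓˢ (inj₁ (hyp p)))
      first x = (col x ∧ inside x) ∧ at-hyp x
      second x = (col x ∧ inside x) ∧ at-face x
      total : Fin n → Bool
      total x = (col x ∧ inside x) ∧ (at-hyp x xor at-face x)

      inside-cong : ∀ {x y} → vert x ≡ vert y → inside x ≡ inside y
      inside-cong eq = cong (λ v → does (ℓᵐ (merge v) ≟ᵐ ℓᵐ (merge (vert p)))) eq

      first-even : Xor.sum first ≡ false
      first-even = Parity.sum-invariant a2 a2-inv a2-free first λ x →
        cong₂ _∧_ (cong₂ _∧_ (col-a2 x) (inside-cong (vert-a2 x)))
          (cong (λ e → does (ℓˢ (inj₁ e) ≟ˢ ℓˢ (inj₁ (hyp p)))) (hyp-a2 x))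

      -- From a flag at a centre, `τ` turns around the other end of its edge, to the next edge there
      -- along the same face. At an inner vertex it keeps the colour too, hence the copy of the
      -- face.
      τ : Fin n → Fin n
      τ x = a0 (a1 (a0 x))
      ττ : ∀ x → τ (τ x) ≡ x
      ττ x = trans (cong (a0 ∘ a1) (a0-inv _)) (trans (cong a0 (a1-inv _)) (a0-inv _))
      τ-free : ∀ x → τ x ≢ x
      τ-free x eq = a1-free (a0 x) (trans (sym (a0-inv _)) (cong a0 eq))
      τ-col : ∀ x → col (τ x) ≡ col x
      τ-col x = trans (col-flip _) (trans (cong not (trans (col-a1 _) (col-flip x))) (not-not (col x)))
        where
        not-not : ∀ b → not (not b) ≡ b
        not-not true = refl
        not-not false = refl
      τ-vert : ∀ {x} → col x ≡ true → vert (τ x) ≡ vert x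
      τ-vert {x} eq = trans (vert-a0 _) (trans (vert-a1 (trans (col-flip x) (cong not eq))) (vert-a0 x))
      τ-face : ∀ x → face (τ x) ≡ face x
      τ-face x = trans (face-a0 _) (trans (face-a1 _) (face-a0 x))

      -- Border vertices are merged into `nothing`, which is not in the component of `p`, so every
      -- vertex inside sees one colour only.
      inside-kind : ∀ {x y} → vert x ≡ vert y → inside x ≡ true → kind x ≡ kind y
      inside-kind {x} {y} eq ins with kind x ≟ kind y
      ... | yes k = k
      ... | no ne = ⊥-elim (absurd (trans (sym ins) (dec-false (_ ≟ᵐ _) λ e →
              pne (trans (sym e) (cong ℓᵐ (merge-border (x , y , refl , sym eq , ne)))))))

      second-even : Xor.sum second ≡ false
      second-even = Parity.sum-invariant τ ττ τ-free second inv
        where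
        inv : ∀ x → second (τ x) ≡ second x
        inv x = trans
          (∧∧-guard {c′ = at-face (τ x)} (τ-col x) λ eq → cong (_∧ at-face (τ x)) (inside-cong (τ-vert eq)))
          (∧∧-guard {b = inside x} {c = at-face (τ x)} (refl {x = col x}) λ eq → ∧-guard {inside x} λ ins →
            cong₂ (λ f k → does (ℓˢ (inj₂ (f , k)) ≟ˢ ℓˢ (inj₁ (hyp p)))) (τ-face x)
              (sym (inside-kind (sym (τ-vert eq)) ins)))

      even : Xor.sum total ≡ false
      even = trans (Xor.sum-cong-≗ (λ x → ∧-distribˡ-xor (col x ∧ inside x) (at-hyp x) (at-face x)))
        (trans (Xor.∑-distrib-+ first second) (cong₂ _xor_ first-even second-even))

      total-p : total p ≡ true
      total-p = cong₂ _∧_ (cong₂ _∧_ colp (dec-true (ℓᵐ (merge (vert p)) ≟ᵐ _) refl))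
        (cong₂ _xor_ (dec-true (ℓˢ (inj₁ (hyp p)) ≟ˢ _) refl) (dec-false (_ ≟ˢ _) (sne ∘ sym)))

      total-a1p : total (a1 p) ≡ false
      total-a1p = cong (_∧ (at-hyp (a1 p) xor at-face (a1 p)))
        (trans (cong (col (a1 p) ∧_) (dec-false (_ ≟ᵐ _) (mne ∘ sym))) (∧-zeroʳ _))

      total-inv : ∀ x → x ≢ p → x ≢ a1 p → total (a1 x) ≡ total x
      -- At any other corner, either both flags have the same value of `inside`, or the split edge
      -- does not cross the cut and both totals are false.
      total-inv x x≢p x≢a1p = ∧∧-guard (col-a1 x) λ eq → go eq (others x eq x≢p x≢a1p)
        where
        go : col x ≡ true
           → ℓᵐ (merge (vert x)) ≡ ℓᵐ (merge (vert (a1 x)))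
             ⊎ ℓˢ (inj₁ (hyp x)) ≡ ℓˢ (inj₂ (face x , kind x))
           → inside (a1 x) ∧ (at-hyp (a1 x) xor at-face (a1 x)) ≡ inside x ∧ (at-hyp x xor at-face x)
        go eq = λ where
            (inj₁ e) → cong₂ _∧_ (cong (λ v → does (v ≟ᵐ ℓᵐ (merge (vert p)))) (sym e))
                                 (cong₂ _xor_ hyps fcs)
            (inj₂ e) → let same = cong (λ s → does (s ≟ˢ ℓˢ (inj₁ (hyp p)))) e in
              trans (zero-at (a1 x) (trans hyps (trans same (sym fcs)))) (sym (zero-at x same))
          where
          hyps : at-hyp (a1 x) ≡ at-hyp x
          hyps = cong (λ e → does (ℓˢ (inj₁ e) ≟ˢ ℓˢ (inj₁ (hyp p)))) (hyp-a1 eq)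
          fcs : at-face (a1 x) ≡ at-face x
          fcs = cong₂ (λ f e → does (ℓˢ (inj₂ (f , κ e)) ≟ˢ ℓˢ (inj₁ (hyp p)))) (face-a1 x) (hyp-a1 eq)
          zero-at : ∀ y → at-hyp y ≡ at-face y → inside y ∧ (at-hyp y xor at-face y) ≡ false
          zero-at y same = trans (cong (inside y ∧_)
            (trans (cong (_xor at-face y) same) (xor-same (at-face y)))) (∧-zeroʳ (inside y))

      odd : Xor.sum total ≡ true
      odd = Parity.sum-odd a1 a1-inv a1-free total p total-p total-a1p total-inv

    Covers : List (Fin n) → List (Fin n) → Set
    Covers Q L = ∀ g → col g ≡ true → (g ∈ Q ⊎ a1 g ∈ Q) ⊎ (g ∈ L ⊎ a1 g ∈ L)

    module _ (Q : List (Fin n)) (q : Fin n) (L : List (Fin n))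
      (covers : Covers Q (q ∷ L)) (colq : col q ≡ true) where
      private
        ℓᵐ = UFᵐ.label (map merged-edge Q)
        ℓˢ = UFˢ.label (map split-edge L)

        agree : ∀ g → col g ≡ true → g ≢ q → g ≢ a1 q →
          ℓᵐ (merge (vert g)) ≡ ℓᵐ (merge (vert (a1 g))) ⊎ ℓˢ (inj₁ (hyp g)) ≡ ℓˢ (inj₂ (face g , kind g))
        agree g eq g≢q g≢a1q with covers g eq
        ... | inj₁ (inj₁ g∈) = inj₁ (UFᵐ.label-sound (map merged-edge Q) (∈-map⁺ merged-edge g∈))
        ... | inj₁ (inj₂ g∈) = inj₁ (sym (trans (UFᵐ.label-sound (map merged-edge Q) (∈-map⁺ merged-edge g∈))
                                 (cong (ℓᵐ ∘ merge ∘ vert) (a1-inv g))))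
        ... | inj₂ (inj₁ (here refl)) = ⊥-elim (g≢q refl)
        ... | inj₂ (inj₂ (here e)) = ⊥-elim (g≢a1q (trans (sym (a1-inv g)) (cong a1 e)))
        ... | inj₂ (inj₁ (there g∈)) = inj₂ (UFˢ.label-sound (map split-edge L) (∈-map⁺ split-edge g∈))
        ... | inj₂ (inj₂ (there g∈)) = inj₂ (trans (cong (ℓˢ ∘ inj₁) (sym (hyp-a1 eq)))
                (trans (UFˢ.label-sound (map split-edge L) (∈-map⁺ split-edge g∈))
                  (cong₂ (λ f e → ℓˢ (inj₂ (f , κ e))) (face-a1 g) (hyp-a1 eq))))

      -- The two ends of the corner have different merged labels, so at least one differs from the
      -- label of the border node. The parity count is started from that end, `q` or `a1 q`.
      redundant-corner : ℓᵐ (merge (vert q)) ≢ ℓᵐ (merge (vert (a1 q)))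
        → ℓˢ (inj₁ (hyp q)) ≢ ℓˢ (inj₂ (face q , kind q)) → ⊥
      redundant-corner mne sne with ℓᵐ (merge (vert q)) ≟ᵐ ℓᵐ nothing
      ... | no pne = no-odd-corner ℓᵐ ℓˢ q colq agree mne sne pne
      ... | yes peq = no-odd-corner ℓᵐ ℓˢ (a1 q) (trans (col-a1 q) colq)
          (λ g eq g≢a1q g≢q → agree g eq (λ e → g≢q (trans e (sym (a1-inv q)))) g≢a1q)
          (λ e → mne (sym (trans e (cong (ℓᵐ ∘ merge ∘ vert) (a1-inv q)))))
          (λ e → sne (trans (cong (ℓˢ ∘ inj₁) (sym (hyp-a1 colq)))
                   (trans e (cong₂ (λ f e → ℓˢ (inj₂ (f , κ e))) (face-a1 q) (hyp-a1 colq)))))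
          (λ e → mne (trans peq (sym e)))

    -- Corners pass one at a time from the split graph to the merged graph. By `redundant-corner`,
    -- `q` cannot both raise the split rank over `L` and the merged rank over `Q`, so each corner
    -- adds at most one to the sum.
    ranks-≤ : ∀ Q L → Covers Q L → (∀ {g} → g ∈ L → col g ≡ true)
      → UFᵐ.rank (map merged-edge (L ʳ++ Q)) + UFˢ.rank (map split-edge L)
        ≤ length L + UFᵐ.rank (map merged-edge Q)
    ranks-≤ Q [] _ _ = ≤-reflexive (+-identityʳ _)
    ranks-≤ Q (q ∷ L) covers centres = begin
      UFᵐ.rank (map merged-edge (L ʳ++ (q ∷ Q))) + UFˢ.rank (map split-edge (q ∷ L))  ≤⟨ one-more ⟩
      suc (length L) + UFᵐ.rank (map merged-edge Q)                                  ∎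
      where
      open ≤-Reasoning
      covers′ : Covers (q ∷ Q) L
      covers′ g eq with covers g eq
      ... | inj₁ (inj₁ g∈) = inj₁ (inj₁ (there g∈))
      ... | inj₁ (inj₂ g∈) = inj₁ (inj₂ (there g∈))
      ... | inj₂ (inj₁ (here e)) = inj₁ (inj₁ (here e))
      ... | inj₂ (inj₂ (here e)) = inj₁ (inj₂ (here e))
      ... | inj₂ (inj₁ (there g∈)) = inj₂ (inj₁ g∈)
      ... | inj₂ (inj₂ (there g∈)) = inj₂ (inj₂ g∈)
      ih = ranks-≤ (q ∷ Q) L covers′ (centres ∘ there)
      one-more : UFᵐ.rank (map merged-edge (L ʳ++ (q ∷ Q))) + UFˢ.rank (map split-edge (q ∷ L))
                 ≤ suc (length L) + UFᵐ.rank (map merged-edge Q)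
      one-more with UFˢ.label (map split-edge L) (inj₁ (hyp q))
                    ≟ˢ UFˢ.label (map split-edge L) (inj₂ (face q , kind q))
                  | UFᵐ.label (map merged-edge Q) (merge (vert q))
                    ≟ᵐ UFᵐ.label (map merged-edge Q) (merge (vert (a1 q)))
                  | ih
      ... | yes _ | yes _ | ih = ≤-trans ih (n≤1+n _)
      ... | yes _ | no _ | ih = ≤-trans ih (≤-reflexive (+-suc _ _))
      ... | no _ | yes _ | ih = ≤-trans (≤-reflexive (+-suc _ _)) (s≤s ih)
      ... | no sne | no mne | _ = ⊥-elim (redundant-corner Q q L covers (centres (here refl)) mne sne)

    corner-edgesˢ = map split-edge corners
    corner-edgesᵐ = map merged-edge (reverse corners)

    labelˢ = UFˢ.label corner-edgesˢ
    labelᵐ = UFᵐ.label corner-edgesᵐ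

    inner? : ∀ v → Dec (col (node-rep v) ≡ false × ¬ Border v)
    inner? v = (col (node-rep v) ≟ᵇ false) ×-dec ¬? (border? v)

    inners borders : List (Fin nN)
    inners = filter inner? (allFin nN)
    borders = filter border? (allFin nN)

    mixeds : List (Fin nF)
    mixeds = filter mixed? (allFin nF)

    rank-sum : UFᵐ.rank corner-edgesᵐ + UFˢ.rank corner-edgesˢ ≤ nE
    rank-sum = ≤-trans (ranks-≤ [] corners (λ g eq → inj₂ (corners-cover g eq)) corners-centre)
      (≤-trans (≤-reflexive (+-identityʳ _)) corners-≤-edges)

    labelˢ-corner : ∀ x → labelˢ (inj₁ (hyp x)) ≡ labelˢ (inj₂ (face x , kind x))
    labelˢ-corner x = subst (λ e → labelˢ (inj₁ e) ≡ labelˢ (inj₂ (face x , κ e))) (hyp-centre x)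
      (subst (λ f → labelˢ (inj₁ (hyp (centre x))) ≡ labelˢ (inj₂ (f , kind (centre x)))) (face-centre x)
        (at (centre x) (col-centre x)))
      where
      at : ∀ g → col g ≡ true → labelˢ (inj₁ (hyp g)) ≡ labelˢ (inj₂ (face g , kind g))
      at g eq with corners-cover g eq
      ... | inj₁ g∈ = UFˢ.label-sound corner-edgesˢ (∈-map⁺ split-edge g∈)
      ... | inj₂ g∈ = trans (cong (labelˢ ∘ inj₁) (sym (hyp-a1 eq)))
              (trans (UFˢ.label-sound corner-edgesˢ (∈-map⁺ split-edge g∈))
                (cong₂ (λ f e → labelˢ (inj₂ (f , κ e))) (face-a1 g) (hyp-a1 eq)))

    -- The merged graph is connected: only `a1` at a centre changes the vertex, and there a corner
    -- joins the two ends.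
    labelᵐ-constant : ∀ x y → labelᵐ (merge (vert x)) ≡ labelᵐ (merge (vert y))
    labelᵐ-constant x = flag-induction (λ y → ℓ x ≡ ℓ y)
      (λ {y} eq → trans eq (sym (cong (labelᵐ ∘ merge) (vert-a0 y))))
      (λ {y} eq → trans eq (step y))
      (λ {y} eq → trans eq (sym (cong (labelᵐ ∘ merge) (vert-a2 y)))) {x} refl
      where
      ℓ : Fin n → Merged
      ℓ y = labelᵐ (merge (vert y))
      step : ∀ y → ℓ y ≡ ℓ (a1 y)
      step y with col y in eq
      ... | false = sym (cong (labelᵐ ∘ merge) (vert-a1 eq))
      ... | true with corners-cover y eq
      ...   | inj₁ y∈ = UFᵐ.label-sound corner-edgesᵐ (∈-map⁺ merged-edge (reverse⁺ y∈))
      ...   | inj₂ y∈ = sym (trans (UFᵐ.label-sound corner-edgesᵐ (∈-map⁺ merged-edge (reverse⁺ y∈)))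
                          (cong ℓ (a1-inv y)))

    -- The colour can change only under `a1` at a vertex, and such a vertex is a border vertex.
    kind-constant : (∀ v → ¬ Border v) → ∀ x y → kind x ≡ kind y
    kind-constant none x = flag-induction (λ y → kind x ≡ kind y)
      (λ {y} eq → trans eq (sym (cong κ (hyp-a0 y))))
      (λ {y} eq → trans eq (step y))
      (λ {y} eq → trans eq (sym (cong κ (hyp-a2 y)))) {x} refl
      where
      step : ∀ y → kind y ≡ kind (a1 y)
      step y with col y in eq
      ... | true = sym (cong κ (hyp-a1 eq))
      ... | false with kind y ≟ kind (a1 y)
      ...   | yes e = e
      ...   | no ne = ⊥-elim (none (vert y) (y , a1 y , refl , vert-a1 eq , ne))

    module _ (conn : ∀ c → Conn (λ e → κ e ≡ c)) (sample : Fin 3 → Fin h)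
      (κ-sample : ∀ c → κ (sample c) ≡ c) where

      labels : List Split
      labels = map (labelˢ ∘ inj₁ ∘ sample) (allFin 3)

      -- Adjacent hyperedges of one colour hang on the same coloured copy of a common face, so each
      -- connected colour class lies in a single split component.
      label-hyp : ∀ e → labelˢ (inj₁ e) ∈ labels
      label-hyp e = subst (_∈ labels)
        (sym (Conn-ind (conn (κ e)) (λ e′ → labelˢ (inj₁ e′) ≟ˢ labelˢ (inj₁ (sample (κ e))))
          (κ-sample (κ e)) refl step refl))
        (∈-map⁺ (labelˢ ∘ inj₁ ∘ sample) (∈-allFin (κ e)))
        where
        step : ∀ {x y} → labelˢ (inj₁ x) ≡ labelˢ (inj₁ (sample (κ e))) → κ x ≡ κ e → κ y ≡ κ e
             → x ~ y → labelˢ (inj₁ y) ≡ labelˢ (inj₁ (sample (κ e)))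
        step eq κx κy (gx , gy , refl , refl , fxy) = trans (labelˢ-corner gy)
          (trans (cong₂ (λ f c → labelˢ (inj₂ (f , c))) (sym fxy) (trans κy (sym κx)))
            (trans (sym (labelˢ-corner gx)) eq))

      -- Two copies suffice to count a mixed face twice, even if it meets three colours. On other
      -- faces the second colour is a default equal to the first.
      first-colour second-colour : Fin nF → Fin 3
      first-colour f = kind (face-rep f)
      second-colour f with mixed? f
      ... | yes (x , _) = kind x
      ... | no _ = first-colour f

      second-flag : ∀ f → ∃[ x ] (face x ≡ f × second-colour f ≡ kind x)
      second-flag f with mixed? f
      ... | yes (x , fx , _) = x , fx , refl
      ... | no _ = face-rep f , face-face-rep f , refl

      second≢first : ∀ {f} → Mixed f → second-colour f ≢ first-colour f
      second≢first {f} m with mixed? f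
      ... | yes (_ , _ , ne) = ne
      ... | no nm = ⊥-elim (nm m)

      first-copies second-copies split-nodes : List Split
      first-copies = map (λ f → inj₂ (f , first-colour f)) (allFin nF)
      second-copies = map (λ f → inj₂ (f , second-colour f)) mixeds
      split-nodes = map inj₁ (allFin h) ++ (first-copies ++ second-copies)

      split-nodes-unique : Unique split-nodes
      split-nodes-unique = Unique.++⁺ (Unique.map⁺ inj₁-injective (Unique.allFin⁺ h))
        (Unique.++⁺ (Unique.map⁺ (cong proj₁ ∘ inj₂-injective) (Unique.allFin⁺ nF))
          (Unique.map⁺ (cong proj₁ ∘ inj₂-injective) (Unique.filter⁺ mixed? (Unique.allFin⁺ nF)))
          disjoint₂)
        disjoint₁
        where
        disjoint₂ : ∀ {s} → ¬ (s ∈ first-copies × s ∈ second-copies)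
        disjoint₂ (s∈ , s∈′) with ∈-map⁻ (λ f → inj₂ (f , first-colour f)) s∈
                                | ∈-map⁻ (λ f → inj₂ (f , second-colour f)) s∈′
        ... | f , _ , refl | f′ , f′∈ , eq with inj₂-injective eq
        ...   | pair-eq with cong proj₁ pair-eq
        ...     | refl = second≢first (proj₂ (∈-filter⁻ mixed? {xs = allFin nF} f′∈)) (sym (cong proj₂ pair-eq))
        disjoint₁ : ∀ {s} → ¬ (s ∈ map inj₁ (allFin h) × s ∈ first-copies ++ second-copies)
        disjoint₁ (s∈ , s∈′) with ∈-map⁻ inj₁ s∈ | ∈-++⁻ first-copies s∈′
        ... | _ , _ , refl | inj₁ s∈₁ with ∈-map⁻ (λ f → inj₂ (f , first-colour f)) s∈₁
        ...   | _ , _ , ()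
        disjoint₁ (s∈ , s∈′) | _ , _ , refl | inj₂ s∈₂ with ∈-map⁻ (λ f → inj₂ (f , second-colour f)) s∈₂
        ...   | _ , _ , ()

      label-node : ∀ {s} → s ∈ split-nodes → labelˢ s ∈ labels
      label-node s∈ with ∈-++⁻ (map inj₁ (allFin h)) s∈
      ... | inj₁ s∈₁ with ∈-map⁻ inj₁ s∈₁
      ...   | e , _ , refl = label-hyp e
      label-node s∈ | inj₂ s∈₂ with ∈-++⁻ first-copies s∈₂
      ... | inj₁ s∈₃ with ∈-map⁻ (λ f → inj₂ (f , first-colour f)) s∈₃
      ...   | f , _ , refl = subst (_∈ labels)
              (trans (labelˢ-corner (face-rep f))
                (cong (λ f′ → labelˢ (inj₂ (f′ , first-colour f))) (face-face-rep f)))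
              (label-hyp (hyp (face-rep f)))
      label-node s∈ | inj₂ s∈₂ | inj₂ s∈₃ with ∈-map⁻ (λ f → inj₂ (f , second-colour f)) s∈₃
      ...   | f , _ , refl = let x , fx , kx = second-flag f in subst (_∈ labels)
              (trans (labelˢ-corner x) (cong₂ (λ f′ c → labelˢ (inj₂ (f′ , c))) fx (sym kx)))
              (label-hyp (hyp x))

      -- The left side counts nodes of the split graph that lie in at most three components, one for
      -- each colour.
      split-count : h + (nF + length mixeds) ≤ UFˢ.rank corner-edgesˢ + 3
      split-count = ≤-trans (≤-reflexive (sym len))
        (≤-trans (UFˢ.unique-≤-rank corner-edgesˢ split-nodes-unique label-node)
          (≤-reflexive (cong (UFˢ.rank corner-edgesˢ +_) (length-map (labelˢ ∘ inj₁ ∘ sample) (allFin 3)))))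
        where
        len : length split-nodes ≡ h + (nF + length mixeds)
        len = trans (length-++ (map inj₁ (allFin h))) (cong₂ _+_
          (trans (length-map inj₁ (allFin h)) (length-allFin h))
          (trans (length-++ first-copies) (cong₂ _+_
            (trans (length-map (λ f → inj₂ (f , first-colour f)) (allFin nF)) (length-allFin nF))
            (length-map _ mixeds))))

      border-exists : ∃ Border
      border-exists with any? border?
      ... | yes b = b
      ... | no none = ⊥-elim (zero≢one (trans (sym (kind-sample zero))
              (trans (kind-constant (λ v b → none (v , b)) _ _) (kind-sample (suc zero)))))
        where
        zero≢one : ¬ (_≡_ {A = Fin 3} zero (suc zero))
        zero≢one ()
        kind-sample : ∀ c → kind (hyp-rep (sample c)) ≡ c
        kind-sample c = trans (cong κ (hyp-hyp-rep (sample c))) (κ-sample c)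

      -- The inner vertices together with `nothing` lie in one component of the merged graph. A
      -- border vertex exists because several colours occur, and it ties `nothing` to that
      -- component.
      inner-count : length inners ≤ UFᵐ.rank corner-edgesᵐ
      inner-count = +-cancelʳ-≤ 1 _ _ (≤-trans
        (≤-reflexive (trans (+-comm _ 1) (cong suc (sym (length-map just inners)))))
        (UFᵐ.unique-≤-rank corner-edgesᵐ {nothing ∷ map just inners} {labelᵐ nothing ∷ []}
          (All.tabulate (λ v∈ eq → nothing∉ (subst (_∈ map just inners) (sym eq) v∈))
            ∷ Unique.map⁺ just-injective (Unique.filter⁺ inner? (Unique.allFin⁺ nN)))
          λ { (here refl) → here refl ; (there v∈) → here (inner-label v∈) }))
        where
        nothing∉ : nothing ∉ map just inners
        nothing∉ v∈ with ∈-map⁻ just v∈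
        ... | _ , _ , ()
        inner-label : ∀ {v} → v ∈ map just inners → labelᵐ v ≡ labelᵐ nothing
        inner-label v∈ with ∈-map⁻ just v∈ | border-exists
        ... | v , v∈inner , refl | b , border@(x , _ , refl , _) with ∈-filter⁻ inner? {xs = allFin nN} v∈inner
        ...   | _ , colv , nb = trans (cong labelᵐ (sym at-v))
                (trans (labelᵐ-constant (node-rep v) x) (cong labelᵐ (merge-border border)))
          where
          vert-v : vert (node-rep v) ≡ v
          vert-v = trans (vert-end _) (trans (cong node (end-false colv)) (node-node-rep v))
          at-v : merge (vert (node-rep v)) ≡ just v
          at-v = trans (cong merge vert-v) (merge-inner nb)

      node-count : nN ≤ h + (length inners + length borders)
      node-count = ≤-trans (≤-reflexive (sym (length-allFin nN)))
        (≤-trans (unique-⊆-≤ (Unique.allFin⁺ nN) sub)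
          (≤-reflexive (trans (length-++ hyperedges) (cong (h +_) (length-++ inners)))))
        where
        sub : ∀ {v} → v ∈ allFin nN → v ∈ hyperedges ++ (inners ++ borders)
        sub {v} v∈ with col (node-rep v) in eq
        ... | true = ∈-++⁺ˡ (∈-filter⁺ is-hyperedge? v∈ eq)
        ... | false with border? v
        ...   | yes b = ∈-++⁺ʳ hyperedges (∈-++⁺ʳ inners (∈-filter⁺ border? v∈ b))
        ...   | no nb = ∈-++⁺ʳ hyperedges (∈-++⁺ˡ (∈-filter⁺ inner? v∈ (eq , nb)))

      -- Both spanning forests together have at most `nE` edges. The 3 components of the split graph
      -- against the 2 in Euler's formula leave the constant 1.
      mixed-≤-border : ∀ {k} → k + nN + nF ≡ 2 + nE → length mixeds ≤ length borders + 1 + k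
      mixed-≤-border {k} euler = +-cancelʳ-≤ (h + nF + length inners) _ _ (begin
        m + (h + nF + i)                       ≡⟨ arrange₁ m h nF i ⟩
        i + (h + (nF + m))                     ≤⟨ +-mono-≤ inner-count split-count ⟩
        rᵐ + (rˢ + 3)                          ≡⟨ +-assoc rᵐ rˢ 3 ⟨
        rᵐ + rˢ + 3                            ≤⟨ +-monoˡ-≤ 3 rank-sum ⟩
        nE + 3                                 ≡⟨ arrange₂ nE ⟩
        2 + nE + 1                             ≡⟨ cong (_+ 1) euler ⟨
        k + nN + nF + 1                        ≤⟨ +-monoˡ-≤ 1 (+-monoˡ-≤ nF (+-monoʳ-≤ k node-count)) ⟩
        k + (h + (i + b)) + nF + 1             ≡⟨ arrange₃ k h i b nF ⟩
        b + 1 + k + (h + nF + i)               ∎)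
        where
        open ≤-Reasoning
        m = length mixeds
        i = length inners
        b = length borders
        rᵐ = UFᵐ.rank corner-edgesᵐ
        rˢ = UFˢ.rank corner-edgesˢ
        arrange₁ : ∀ m h f i → m + (h + f + i) ≡ i + (h + (f + m))
        arrange₁ = solve-∀
        arrange₂ : ∀ e → e + 3 ≡ 2 + e + 1
        arrange₂ = solve-∀
        arrange₃ : ∀ k h i b f → k + (h + (i + b)) + f + 1 ≡ b + 1 + k + (h + f + i)
        arrange₃ = solve-∀

-- Tree-decompositions grown by attaching leaves.

module Growth {F : Set} where

  mutual
    -- The node attached last is zero.
    data Growing : ℕ → Set where
      start  : List F → Growing 1
      attach : ∀ {m} (D : Growing m) (i : Fin m) (b : List F)
             → (∀ v j → v ∈ b → v ∈ bag D j → v ∈ bag D i) → Growing (suc m)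

    bag : ∀ {m} → Growing m → Fin m → List F
    bag (start b) _ = b
    bag (attach D i b _) zero = b
    bag (attach D i b _) (suc j) = bag D j

  Adj : ∀ {m} → Growing m → Fin m → Fin m → Set
  Adj (start _) _ _ = ⊥
  Adj (attach D i _ _) zero zero = ⊥
  Adj (attach D i _ _) zero (suc y) = y ≡ i
  Adj (attach D i _ _) (suc x) zero = x ≡ i
  Adj (attach D i _ _) (suc x) (suc y) = Adj D x y

  Adj-sym : ∀ {m} (D : Growing m) {x y} → Adj D x y → Adj D y x
  Adj-sym (attach D i _ _) {zero} {suc y} a = a
  Adj-sym (attach D i _ _) {suc x} {zero} a = a
  Adj-sym (attach D i _ _) {suc x} {suc y} a = Adj-sym D a

  Adj-irrefl : ∀ {m} (D : Growing m) {x} → ¬ Adj D x x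
  Adj-irrefl (attach D i _ _) {suc x} a = Adj-irrefl D a

  Path : ∀ {m} → Growing m → Fin m → Fin m → List (Fin m) → Set
  Path D x z p = head p ≡ just x × last p ≡ just z × Linked (Adj D) p × Unique p

  Path-suc : ∀ {m} (D : Growing m) i b inv {x z p} → Path D x z p
    → Path (attach D i b inv) (suc x) (suc z) (map suc p)
  Path-suc D i b inv {p = x ∷ p} (refl , lst , lp , up) =
    refl , last-map-suc (x ∷ p) lst , Linked.map⁺ lp , Unique.map⁺ suc-injective up

  path : ∀ {m} (D : Growing m) x z → ∃[ p ] Path D x z p
  path (start _) zero zero = zero ∷ [] , refl , refl , [-] , [] ∷ []
  path (attach D i b inv) zero zero = zero ∷ [] , refl , refl , [-] , [] ∷ []
  path (attach D i b inv) (suc x) (suc z) = let p , pth = path D x z in map suc p , Path-suc D i b inv pth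
  path (attach D i b inv) zero (suc z) with path D i z
  ... | .i ∷ p , pth@(refl , _) with Path-suc D i b inv pth
  ...   | _ , lst , lp , up = zero ∷ map suc (i ∷ p) , refl , lst , refl ∷ lp
          , All.tabulate (λ v∈ eq → zero∉map-suc (subst (_∈ map suc (i ∷ p)) (sym eq) v∈)) ∷ up
  path (attach D i b inv) (suc x) zero with path D x i
  ... | .x ∷ p , pth@(refl , _) with Path-suc D i b inv pth
  ...   | _ , lst , lp , up = map suc (x ∷ p) ++ zero ∷ [] , refl , last-snoc (map suc (x ∷ p))
          , Linked.++⁺ lp (subst (λ l → Connected.Connected (Adj (attach D i b inv)) l (just zero)) (sym lst) (Connected.just refl)) [-]
          , Unique.++⁺ up ([] ∷ []) λ { (v∈ , here refl) → zero∉map-suc v∈ }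

  -- A path meets the newest leaf at most at its two ends.
  data LeafView {m} (D : Growing m) (i : Fin m) : List (Fin (suc m)) → Set where
    only  : LeafView D i (zero ∷ [])
    first : ∀ p → Linked (Adj D) (i ∷ p) → Unique (i ∷ p) → LeafView D i (zero ∷ map suc (i ∷ p))
    none  : ∀ x p → Linked (Adj D) (x ∷ p) → Unique (x ∷ p) → LeafView D i (map suc (x ∷ p))
    final : ∀ x p → Linked (Adj D) (x ∷ p) → Unique (x ∷ p) → last (x ∷ p) ≡ just i
          → LeafView D i (map suc (x ∷ p) ++ zero ∷ [])

  module _ {m} (D : Growing m) (i : Fin m) (b : List F)
    (inv : ∀ v j → v ∈ b → v ∈ bag D j → v ∈ bag D i) where
    private
      D⁺ = attach D i b inv

    -- The newest leaf has the single neighbour `i`; a path that enters it from `i` has to stop, as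
    -- going on would repeat `i`.
    strip : ∀ x p → Linked (Adj D⁺) (suc x ∷ p) → Unique (suc x ∷ p)
      → (∃[ p′ ] p ≡ map suc p′)
        ⊎ (∃[ p′ ] (p ≡ map suc p′ ++ zero ∷ [] × last (x ∷ p′) ≡ just i))
    strip x [] _ _ = inj₁ ([] , refl)
    strip x (suc y ∷ p) (_ ∷ lp) (_ ∷ up) with strip y p lp up
    ... | inj₁ (p′ , refl) = inj₁ (y ∷ p′ , refl)
    ... | inj₂ (p′ , refl , lst) = inj₂ (y ∷ p′ , refl , lst)
    strip x (zero ∷ []) (refl ∷ _) _ = inj₂ ([] , refl , refl)
    strip x (zero ∷ suc y ∷ p) (refl ∷ refl ∷ _) ((_ ∷ ne ∷ _) ∷ _) = ⊥-elim (ne refl)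

    leaf-view : ∀ x p → Linked (Adj D⁺) (x ∷ p) → Unique (x ∷ p) → LeafView D i (x ∷ p)
    leaf-view zero [] _ _ = only
    leaf-view zero (suc y ∷ p) (refl ∷ lp) (z∉ ∷ up) with strip y p lp up
    ... | inj₁ (p′ , refl) = first p′ (Linked.map⁻ lp) (Unique.map⁻ up)
    ... | inj₂ (p′ , refl , _) = ⊥-elim (All.lookup z∉ (there (∈-++⁺ʳ (map suc p′) (here refl))) refl)
    leaf-view (suc x) p lp up with strip x p lp up
    ... | inj₁ (p′ , refl) = none x p′ (Linked.map⁻ lp) (Unique.map⁻ up)
    ... | inj₂ (p′ , refl , lst) = final x p′ (Linked.map⁻ (linked-init (map suc (x ∷ p′)) lp))
            (Unique.map⁻ (unique-init (map suc (x ∷ p′)) up)) lst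

  -- No cycle passes through the newest leaf, since both cycle edges at it would lead to `i`; the
  -- other cycles lie in the older tree.
  acyclic : ∀ {m} (D : Growing m) p → 3 ≤ length p → Linked (Adj D) p → Unique p
          → ∀ {x z} → head p ≡ just x → last p ≡ just z → ¬ Adj D z x
  acyclic (start _) p _ _ _ _ _ ()
  acyclic (attach D i b inv) (x ∷ p) 3≤ lp up refl lst zx with leaf-view D i b inv x p lp up
  acyclic (attach D i b inv) _ (s≤s ()) _ _ _ _ _ | only
  acyclic (attach D i b inv) _ (s≤s (s≤s ())) _ _ _ _ _ | first [] _ _
  acyclic (attach D i b inv) _ _ _ _ refl lst zx | first (y ∷ p) _ (i∉ ∷ _) with last-map-suc⁻ (y ∷ p) lst
  ... | z , refl , lst′ = All.lookup i∉ (last-∈ (y ∷ p) lst′) (sym zx)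
  acyclic (attach D i b inv) _ 3≤ _ _ refl lst zx | none x p lp up with last-map-suc⁻ (x ∷ p) lst
  ... | z , refl , lst′ = acyclic D (x ∷ p) (≤-trans 3≤ (≤-reflexive (length-map suc (x ∷ p)))) lp up refl lst′ zx
  acyclic (attach D i b inv) _ (s≤s (s≤s ())) _ _ refl lst zx | final x [] _ _ _
  acyclic (attach D i b inv) _ _ _ _ refl lst zx | final x (y ∷ p) _ (x∉ ∷ _) lst′
    with trans (sym (last-snoc (map suc (x ∷ y ∷ p)))) lst
  ... | refl = All.lookup x∉ (last-∈ (y ∷ p) lst′) zx

  -- By the condition in `attach`, an element of the newest bag that occurs at another node also
  -- lies in the bag at `i`, from where the rest of the path runs in the older tree.
  interpolate : ∀ {m} (D : Growing m) p → Linked (Adj D) p → Unique p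
    → ∀ {x y z v} → head p ≡ just x → last p ≡ just z → y ∈ p
    → v ∈ bag D x → v ∈ bag D z → v ∈ bag D y
  interpolate (start _) _ _ _ _ _ _ v∈ _ = v∈
  interpolate (attach D i b inv) (x ∷ p) lp up hd lst y∈ v∈x v∈z with leaf-view D i b inv x p lp up
  interpolate (attach D i b inv) _ _ _ refl _ (here refl) v∈x _ | only = v∈x
  interpolate (attach D i b inv) _ _ _ refl _ (here refl) v∈x _ | first p _ _ = v∈x
  interpolate (attach D i b inv) _ _ _ refl lst (there y∈) v∈x v∈z | first p lp up
    with last-map-suc⁻ (i ∷ p) lst | ∈-map⁻ suc y∈
  ... | z , refl , lst′ | y , y∈p , refl = interpolate D (i ∷ p) lp up refl lst′ y∈p (inv _ _ v∈x v∈z) v∈z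
  interpolate (attach D i b inv) _ _ _ refl lst y∈ v∈x v∈z | none x p lp up
    with last-map-suc⁻ (x ∷ p) lst | ∈-map⁻ suc y∈
  ... | z , refl , lst′ | y , y∈p , refl = interpolate D (x ∷ p) lp up refl lst′ y∈p v∈x v∈z
  interpolate (attach D i b inv) _ _ _ refl lst y∈ v∈x v∈z | final x p lp up lst′
    with trans (sym (last-snoc (map suc (x ∷ p)))) lst | ∈-++⁻ (map suc (x ∷ p)) y∈
  ... | refl | inj₂ (here refl) = v∈z
  ... | refl | inj₁ y∈₁ with ∈-map⁻ suc y∈₁
  ...   | y , y∈p , refl = interpolate D (x ∷ p) lp up refl lst′ y∈p v∈x (inv _ _ v∈z v∈x)

  tree : ∀ {m} → Growing m → Tree m
  tree D = record
    { Adj = Adj D ; symm = Adj-sym D ; irrefl = Adj-irrefl D ; nonempty = nonempty D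
    ; connected = path D ; acyclic = acyclic D }
    where
    nonempty : ∀ {m} → Growing m → 1 ≤ m
    nonempty (start _) = s≤s z≤n
    nonempty (attach _ _ _ _) = s≤s z≤n

-- The tree-decomposition of the dual.

module Dual
  (H : SurfaceHypergraph) {nN nF nE : ℕ}
  (nodes : Classes (SurfaceHypergraph.SameNode H) nN)
  (faces : Classes (SurfaceHypergraph.SameFace H) nF)
  (edges : Classes (SurfaceHypergraph.SameEdge H) nE)
  {k w a : ℕ} (euler : k + nN + nF ≡ 2 + nE)
  (two : AtLeastTwoHyperedges H) (no-cut : ∀ e → ¬ CutEdge H e)
  (td : TreeDecomposition (primalHG H) w) (dual-rank : DualRankAtMost H a)
  where

  open SurfaceHypergraph H hiding (map; EulerGenus; AtLeastTwoHyperedges; Pending; CutEdge)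
  open Surface H nodes faces
  open Counting H nodes faces edges using (module Colouring)
  open TreeDecomposition td using (T) renaming
    (m to mᵀ; bag to bagᵀ; InBag to InBagᵀ; width to widthᵀ;
     cover-edge to cover-edgeᵀ; interpolate to interpolateᵀ)

  _∈ᵉ_ : Fin nN → Fin h → Set
  v ∈ᵉ e = ∃[ x ] (vert x ≡ v × hyp x ≡ e)

  _∈ᵇ_ : Fin nN → Fin mᵀ → Set
  v ∈ᵇ t = ∃[ u ] (u ∈ bagᵀ t × node u ≡ v)

  _∈ᵇ?_ : ∀ v t → Dec (v ∈ᵇ t)
  v ∈ᵇ? t with Any.any? (λ u → node u ≟ v) (bagᵀ t)
  ... | yes found = yes (find found)
  ... | no ¬found = no λ (u , u∈ , eq) → ¬found (lose u∈ eq)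

  home : Fin h → Fin mᵀ
  home e = proj₁ (cover-edgeᵀ (hyp-rep e) (col-hyp-rep e))

  same-hyp : ∀ {x e} → hyp x ≡ e → SameNode (hyp-rep e) (centre x)
  same-hyp {x} {e} eq = subst (λ y → SameNode y (centre x)) (centre-true (col-hyp-rep e))
    (hyp⇒ (trans (hyp-hyp-rep e) (sym eq)))

  col-end : ∀ x → col (end x) ≡ false
  col-end x with col x in eq
  ... | true = trans (col-flip x) (cong not eq)
  ... | false = eq

  a0-centre : ∀ x → a0 (centre x) ≡ end x
  a0-centre x with col x
  ... | true = refl
  ... | false = a0-inv x

  home-covers : ∀ {v e} → v ∈ᵉ e → v ∈ᵇ home e
  home-covers {v} {e} (x , refl , hx) =
    let u , u∈ , same = proj₂ (cover-edgeᵀ (hyp-rep e) (col-hyp-rep e)) (end x) (col-end x)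
                          (centre x , same-hyp hx , subst (λ y → SameNode y (end x)) (sym (a0-centre x)) ε)
    in u , u∈ , trans (⇒node same) (sym (vert-end x))

  interpolate : ∀ x y z → Tree.OnPath T x y z → ∀ v → v ∈ᵇ x → v ∈ᵇ z → v ∈ᵇ y
  interpolate x y z on v v∈x v∈z =
    let u , u∈ , same = interpolateᵀ x y z on (node-rep v) (to v∈x) (to v∈z)
    in u , u∈ , trans (⇒node same) (node-node-rep v)
    where
    to : ∀ {t} → v ∈ᵇ t → InBagᵀ (node-rep v) t
    to (u , u∈ , eq) = u , u∈ , node⇒ (trans eq (sym (node-node-rep v)))

  e₀ e₁ : Fin h
  e₀ = hyp (proj₁ two)
  e₁ = hyp (proj₁ (proj₂ two))

  e₁≢e₀ : e₁ ≢ e₀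
  e₁≢e₀ eq = let x , y , cx , cy , ne = two in
    ne (subst (λ z → SameNode z y) (centre-true cx)
         (subst (SameNode (centre x)) (centre-true cy) (hyp⇒ (sym eq))))

  open Peeling _~?_ ~-sym hyperedges-connected (hyperedges-connected-minus no-cut) T _∈ᵉ_ _∈ᵇ_
    interpolate home home-covers e₀
  open Narrow hyperedges-connected {Sep = Sep} (λ sep v v∈y v∈x → sep v v∈x v∈y)

  On : Fin nF → Fin h → Set
  On f e = ∃[ x ] (face x ≡ f × hyp x ≡ e)

  on? : ∀ e f → Dec (On f e)
  on? e f = any? λ x → (face x ≟ f) ×-dec (hyp x ≟ e)

  faces-of : Fin h → List (Fin nF)
  faces-of e = filter (on? e) (allFin nF)

  bound : ℕ
  bound = suc ((w + 1 + k) ⊔ (a ∸ 1))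

  faces-of-≤ : ∀ e → length (faces-of e) ≤ bound
  faces-of-≤ e = ≤-trans (≤-trans (unique-image-≤ (λ f r → face r ≡ f)
      (Unique.filter⁺ (on? e) (Unique.allFin⁺ nF)) covered (λ p q → trans (sym p) q)) len)
      -- `a` is at most `1 + (a ∸ 1)` for `a` equal to 0 as well, so truncated subtraction does no
      -- harm.
      (≤-trans (m≤n+m∸n a 1) (s≤s (m≤n⊔m (w + 1 + k) (a ∸ 1))))
    where
    reps = proj₁ (dual-rank (hyp-rep e) (col-hyp-rep e))
    len : length reps ≤ a
    len = proj₁ (proj₂ (dual-rank (hyp-rep e) (col-hyp-rep e)))
    covered : ∀ {f} → f ∈ faces-of e → ∃[ r ] (r ∈ reps × face r ≡ f)
    covered f∈ with ∈-filter⁻ (on? e) {xs = allFin nF} f∈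
    ... | _ , x , refl , hx =
      let r , r∈ , same = proj₂ (proj₂ (dual-rank (hyp-rep e) (col-hyp-rep e))) x
                            (centre x , same-hyp hx , face⇒ (face-centre x))
      in r , r∈ , sym (⇒face same)

  -- The three-way partition at an inner node of a good arrangement gives the dual bag of the
  -- faces that meet at least two parts.
  module Parts {X Y Z : Subset h} (Y⊆X : ∀ {x} → x ∈ˢ Y → x ∈ˢ X) (Z⊆X : ∀ {x} → x ∈ˢ Z → x ∈ˢ X)
    (split : ∀ {x} → x ∈ˢ X → x ∈ˢ Y ⊎ x ∈ˢ Z) (disjoint : ∀ {x} → x ∈ˢ Y → x ∉ˢ Z)
    where

    part : Fin h → Fin 3
    part e with e ∈ˢ? Y | e ∈ˢ? Z
    ... | yes _ | _ = 0F
    ... | no _ | yes _ = 1F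
    ... | no _ | no _ = 2F

    part-Y : ∀ {e} → e ∈ˢ Y → part e ≡ 0F
    part-Y {e} e∈ with e ∈ˢ? Y
    ... | yes _ = refl
    ... | no e∉ = ⊥-elim (e∉ e∈)

    part-Z : ∀ {e} → e ∈ˢ Z → part e ≡ 1F
    part-Z {e} e∈ with e ∈ˢ? Y | e ∈ˢ? Z
    ... | yes e∈Y | _ = ⊥-elim (disjoint e∈Y e∈)
    ... | no _ | yes _ = refl
    ... | no _ | no e∉ = ⊥-elim (e∉ e∈)

    part-out : ∀ {e} → e ∉ˢ X → part e ≡ 2F
    part-out {e} e∉ with e ∈ˢ? Y | e ∈ˢ? Z
    ... | yes e∈Y | _ = ⊥-elim (e∉ (Y⊆X e∈Y))
    ... | no _ | yes e∈Z = ⊥-elim (e∉ (Z⊆X e∈Z))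
    ... | no _ | no _ = refl

    part-0 : ∀ {e} → part e ≡ 0F → e ∈ˢ Y
    part-0 {e} eq with e ∈ˢ? Y | e ∈ˢ? Z
    ... | yes e∈ | _ = e∈
    part-0 () | no _ | yes _
    part-0 () | no _ | no _

    part-1 : ∀ {e} → part e ≡ 1F → e ∈ˢ Z
    part-1 {e} eq with e ∈ˢ? Y | e ∈ˢ? Z
    part-1 () | yes _ | _
    ... | no _ | yes e∈ = e∈
    part-1 () | no _ | no _

    part-2 : ∀ {e} → part e ≡ 2F → e ∉ˢ X
    part-2 {e} eq e∈ with e ∈ˢ? Y | e ∈ˢ? Z
    part-2 () e∈ | yes _ | _
    part-2 () e∈ | no _ | yes _
    ... | no e∉Y | no e∉Z = [ e∉Y , e∉Z ]′ (split e∈)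

    open Colouring part public

    same-part : ∀ {x y} → SamePart X Y Z x y → part x ≡ part y
    same-part (inj₁ (x∈ , y∈)) = trans (part-Y x∈) (sym (part-Y y∈))
    same-part (inj₂ (inj₁ (x∈ , y∈))) = trans (part-Z x∈) (sym (part-Z y∈))
    same-part (inj₂ (inj₂ (x∉ , y∉))) = trans (part-out x∉) (sym (part-out y∉))

    same-part⁻ : ∀ {x y} → part x ≡ part y → SamePart X Y Z x y
    same-part⁻ {x} {y} eq with part x in px
    ... | 0F = inj₁ (part-0 px , part-0 (sym eq))
    ... | 1F = inj₂ (inj₁ (part-1 px , part-1 (sym eq)))
    ... | 2F = inj₂ (inj₂ (part-2 px , part-2 (sym eq)))

    mixed-intro : ∀ {x y} → face x ≡ face y → kind x ≢ kind y → face x ∈ mixeds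
    mixed-intro {x} {y} eq ne with kind x ≟ kind (face-rep (face x))
    ... | no ne′ = ∈-filter⁺ mixed? (∈-allFin _) (x , refl , ne′)
    ... | yes e = ∈-filter⁺ mixed? (∈-allFin _) (y , sym eq , λ e′ → ne (trans e (sym e′)))

    mixed-elim : ∀ {f} → f ∈ mixeds → ∃[ x ] ∃[ y ] (face x ≡ f × face y ≡ f × kind x ≢ kind y)
    mixed-elim {f} f∈ with ∈-filter⁻ mixed? {xs = allFin nF} f∈
    ... | _ , x , fx , ne = x , face-rep f , fx , face-face-rep f , ne

    kind-end : ∀ x → kind (end x) ≡ kind x
    kind-end x with col x
    ... | true = cong part (hyp-a0 x)
    ... | false = refl

    -- Consecutive hyperedges around `v` share a face. Were two of them in different parts, `narrow`
    -- would put their common vertex `v` into the bag; so outside the bag the colour stays constant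
    -- all around `v`.
    border-in-bag : ∀ {t} → (∀ {x y} → x ~ y → ¬ SamePart X Y Z x y → Sep t x y)
      → ∀ {v} → Border v → v ∈ᵇ t
    border-in-bag {t} narrow {v} (x , y , refl , vy , ne) with vert x ∈ᵇ? t
    ... | yes v∈ = v∈
    ... | no v∉ = ⊥-elim (ne (trans (sym (kind-end x)) (trans (sym (proj₁ along)) (kind-end y))))
      where
      P : Fin n → Set
      P z = kind z ≡ kind (end x) × vert z ≡ vert x × col z ≡ false
      step1 : ∀ {z} → P z → P (a1 z)
      step1 {z} (kz , vz , cz) with kind (a1 z) ≟ kind z
      ... | yes e = trans e kz , trans (vert-a1 cz) vz , trans (col-a1 z) cz
      ... | no ne′ = ⊥-elim (v∉ (narrow (share-face (sym (face-a1 z))) (λ s → ne′ (sym (same-part s)))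
              (vert x) (z , vz , refl) (a1 z , trans (vert-a1 cz) vz , refl)))
      step2 : ∀ {z} → P z → P (a2 z)
      step2 {z} (kz , vz , cz) = trans (cong part (hyp-a2 z)) kz , trans (vert-a2 z) vz , trans (col-a2 z) cz
      f : ∀ {z u} → Step12 z u → P z → P u
      f (inj₁ refl) = step1
      f (inj₂ refl) = step2
      g : ∀ {z u} → Step12 z u → P u → P z
      g (inj₁ refl) p = subst P (a1-inv _) (step1 p)
      g (inj₂ refl) p = subst P (a2-inv _) (step2 p)
      vert-of-end : ∀ z → vert (end z) ≡ vert z
      vert-of-end z = trans (vert-end (end z)) (trans (cong node (end-false (col-end z))) (sym (vert-end z)))
      along : P (end y)
      along = closure-induction P f g
        (node⇒ (trans (sym (vert-end x)) (trans (sym vy) (vert-end y))))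
        (refl , vert-of-end x , col-end x)

    mixeds-≤ : ∀ {t} → ∃ (_∈ˢ Y) → ∃ (_∈ˢ Z) → ∃ (_∉ˢ X) → Conn (_∈ˢ Y) → Conn (_∈ˢ Z) → Conn (_∉ˢ X)
      → (∀ {x y} → x ~ y → ¬ SamePart X Y Z x y → Sep t x y) → length mixeds ≤ bound
    mixeds-≤ {t} (y , y∈) (z , z∈) (o , o∉) cY cZ cO narrow =
      ≤-trans (mixed-≤-border conn sample sampled euler)
        -- A bag has at most `suc w` vertices, and `suc w + 1 + k` is the successor of `w + 1 + k`.
        (≤-trans (+-monoˡ-≤ k (+-monoˡ-≤ 1 (≤-trans borders-≤ (widthᵀ t)))) (s≤s (m≤m⊔n (w + 1 + k) (a ∸ 1))))
      where
      conn : ∀ c → Conn (λ e → part e ≡ c)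
      conn 0F = Conn-resp part-Y part-0 cY
      conn 1F = Conn-resp part-Z part-1 cZ
      conn 2F = Conn-resp part-out part-2 cO
      sample : Fin 3 → Fin h
      sample 0F = y
      sample 1F = z
      sample 2F = o
      sampled : ∀ c → part (sample c) ≡ c
      sampled 0F = part-Y y∈
      sampled 1F = part-Z z∈
      sampled 2F = part-out o∉
      borders-≤ : length borders ≤ length (bagᵀ t)
      borders-≤ = unique-image-≤ (λ v u → node u ≡ v) (Unique.filter⁺ border? (Unique.allFin⁺ nN))
        (λ v∈ → border-in-bag narrow (proj₂ (∈-filter⁻ border? {xs = allFin nN} v∈)))
        (λ p q → trans (sym p) q)

  open Growth {Fin nF} hiding (interpolate)
  open Growth {Fin nF} using () renaming (interpolate to interpolateᴳ)

  Bounded : ∀ {m} → Growing m → Set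
  Bounded D = ∀ j → length (bag D j) ≤ bound

  -- `origin` limits the faces of the enlarged decomposition, so that a further extension by a
  -- disjoint set can check its own premises.
  record Extension {m} (D : Growing m) (X : Subset h) : Set where
    field
      {size}  : ℕ
      result  : Growing size
      embed   : Fin m → Fin size
      bag-eq  : ∀ j → bag result (embed j) ≡ bag D j
      origin  : ∀ j {f} → f ∈ bag result j → (∃[ j′ ] f ∈ bag D j′) ⊎ (∃[ e ] (e ∈ˢ X × On f e))
      covers  : ∀ {e} → e ∈ˢ X → ∃[ j ] (∀ {f} → On f e → f ∈ bag result j)
      bounded : Bounded result

  module _ {X Y Z : Subset h} (Y⊆X : ∀ {x} → x ∈ˢ Y → x ∈ˢ X) (Z⊆X : ∀ {x} → x ∈ˢ Z → x ∈ˢ X)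
    (split : ∀ {x} → x ∈ˢ X → x ∈ˢ Y ⊎ x ∈ˢ Z)
    {m} {D : Growing m} {i top inv}
    (some-in-X : ∀ {f} → f ∈ top → ∃[ e ] (e ∈ˢ X × On f e))
    (E¹ : Extension (attach D i top inv) Y) (E² : Extension (Extension.result E¹) Z)
    where
    open Extension

    compose : Extension D X
    compose = record
      { result = result E²
      ; embed = λ j → embed E² (embed E¹ (suc j))
      ; bag-eq = λ j → trans (bag-eq E² _) (bag-eq E¹ (suc j))
      ; origin = origin²
      ; covers = covers²
      ; bounded = bounded E² }
      where
      origin² : ∀ j {f} → f ∈ bag (result E²) j → (∃[ j′ ] f ∈ bag D j′) ⊎ (∃[ e ] (e ∈ˢ X × On f e))
      origin² j f∈ with origin E² j f∈
      ... | inj₂ (e , e∈Z , on) = inj₂ (e , Z⊆X e∈Z , on)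
      ... | inj₁ (j¹ , f∈¹) with origin E¹ j¹ f∈¹
      ...   | inj₂ (e , e∈Y , on) = inj₂ (e , Y⊆X e∈Y , on)
      ...   | inj₁ (suc j⁰ , f∈⁰) = inj₁ (j⁰ , f∈⁰)
      ...   | inj₁ (zero , f∈⁰) = inj₂ (some-in-X f∈⁰)
      covers² : ∀ {e} → e ∈ˢ X → ∃[ j ] (∀ {f} → On f e → f ∈ bag (result E²) j)
      covers² e∈X with split e∈X
      ... | inj₁ e∈Y = let j , cov = covers E¹ e∈Y in embed E² j , λ {f} on → subst (f ∈_) (sym (bag-eq E² j)) (cov on)
      ... | inj₂ e∈Z = covers E² e∈Z

  -- The part for `X` is to be hung at `i`, so old faces that touch `X` must be in the bag there.
  -- Old faces also touch the outside of `X`, which makes those touching `X` mixed at the next node.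
  Extendable : Subset h → Set
  Extendable X = ∀ {m} (D : Growing m) (i : Fin m) → Bounded D
    → (∀ j {f} → f ∈ bag D j → ∃[ e ] (e ∉ˢ X × On f e))
    → (∀ j {f e} → f ∈ bag D j → e ∈ˢ X → On f e → f ∈ bag D i)
    → Extension D X

  extend-singleton : ∀ {X} e → e ∈ˢ X → (∀ {x} → x ∈ˢ X → x ≡ e) → Extendable X
  extend-singleton {X} e e∈X only-e D i bnd _ attached = record
    { result = attach D i (faces-of e) λ f j f∈e f∈j → attached j f∈j e∈X (on f∈e)
    ; embed = suc ; bag-eq = λ _ → refl
    ; origin = λ { zero f∈ → inj₂ (e , e∈X , on f∈) ; (suc j) f∈ → inj₁ (j , f∈) }
    ; covers = λ x∈X → zero , λ { (x , fx , hx) → ∈-filter⁺ (on? e) (∈-allFin _) (x , fx , trans hx (only-e x∈X)) }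
    ; bounded = λ { zero → faces-of-≤ e ; (suc j) → bnd j } }
    where
    on : ∀ {f} → f ∈ faces-of e → On f e
    on f∈ = proj₂ (∈-filter⁻ (on? e) {xs = allFin nF} f∈)

  -- A node with bag `top` is hung at `i`, and `Y` and then `Z` are hung at that node. An old face
  -- touching `Y` or `Z` also touches the outside of `X`, and a face brought in by `Y` that touches
  -- `Z` meets two parts; both are mixed, hence in `top`.
  extend-union : ∀ {X Y Z} → (∀ {x} → x ∈ˢ Y → x ∈ˢ X) → (∀ {x} → x ∈ˢ Z → x ∈ˢ X)
    → (∀ {x} → x ∈ˢ X → x ∈ˢ Y ⊎ x ∈ˢ Z) → (∀ {x} → x ∈ˢ Y → x ∉ˢ Z)
    → (top : List (Fin nF)) → length top ≤ bound
    → (∀ {f e e′} → On f e → On f e′ → ¬ SamePart X Y Z e e′ → f ∈ top)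
    → (∀ {f} → f ∈ top → ∃[ e ] ∃[ e′ ] (On f e × On f e′ × ¬ SamePart X Y Z e e′))
    → Extendable Y → Extendable Z → Extendable X
  extend-union {X} {Y} {Z} Y⊆X Z⊆X split disjoint top top-≤ mixed mixed⁻ extY extZ
    {m} D i bnd outer attached =
    compose Y⊆X Z⊆X split some-in-X E¹ E²
    where
    open Extension
    some-in-X : ∀ {f} → f ∈ top → ∃[ e ] (e ∈ˢ X × On f e)
    some-in-X f∈ with mixed⁻ f∈
    ... | e , e′ , on , on′ , ne with e ∈ˢ? X | e′ ∈ˢ? X
    ...   | yes e∈ | _ = e , e∈ , on
    ...   | no _ | yes e′∈ = e′ , e′∈ , on′
    ...   | no e∉ | no e′∉ = ⊥-elim (ne (inj₂ (inj₂ (e∉ , e′∉))))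
    some-not-in : ∀ (W : Subset h) → (∀ {e e′} → e ∈ˢ W → e′ ∈ˢ W → SamePart X Y Z e e′)
      → ∀ {f} → f ∈ top → ∃[ e ] (e ∉ˢ W × On f e)
    some-not-in W same f∈ with mixed⁻ f∈
    ... | e , e′ , on , on′ , ne with e ∈ˢ? W | e′ ∈ˢ? W
    ...   | no e∉ | _ = e , e∉ , on
    ...   | yes _ | no e′∉ = e′ , e′∉ , on′
    ...   | yes e∈ | yes e′∈ = ⊥-elim (ne (same e∈ e′∈))
    D¹ : Growing (suc m)
    D¹ = attach D i top λ f j f∈ f∈j → let e , e∈X , on = some-in-X f∈ in attached j f∈j e∈X on
    bnd¹ : Bounded D¹
    bnd¹ zero = top-≤
    bnd¹ (suc j) = bnd j
    Y≢O : ∀ {e e′} → e ∈ˢ Y → e′ ∉ˢ X → ¬ SamePart X Y Z e e′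
    Y≢O e∈ e′∉ (inj₁ (_ , e′∈)) = e′∉ (Y⊆X e′∈)
    Y≢O e∈ e′∉ (inj₂ (inj₁ (e∈Z , _))) = disjoint e∈ e∈Z
    Y≢O e∈ e′∉ (inj₂ (inj₂ (e∉ , _))) = e∉ (Y⊆X e∈)
    Z≢O : ∀ {e e′} → e ∈ˢ Z → e′ ∉ˢ X → ¬ SamePart X Y Z e e′
    Z≢O e∈ e′∉ (inj₁ (_ , e′∈)) = e′∉ (Y⊆X e′∈)
    Z≢O e∈ e′∉ (inj₂ (inj₁ (_ , e′∈))) = e′∉ (Z⊆X e′∈)
    Z≢O e∈ e′∉ (inj₂ (inj₂ (e∉ , _))) = e∉ (Z⊆X e∈)
    Y≢Z : ∀ {e e′} → e ∈ˢ Y → e′ ∈ˢ Z → ¬ SamePart X Y Z e e′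
    Y≢Z e∈ e′∈ (inj₁ (_ , e′∈Y)) = disjoint e′∈Y e′∈
    Y≢Z e∈ e′∈ (inj₂ (inj₁ (e∈Z , _))) = disjoint e∈ e∈Z
    Y≢Z e∈ e′∈ (inj₂ (inj₂ (e∉ , _))) = e∉ (Y⊆X e∈)
    attachedY : ∀ j {f e} → f ∈ bag D¹ j → e ∈ˢ Y → On f e → f ∈ top
    attachedY zero f∈ _ _ = f∈
    attachedY (suc j) f∈ e∈Y on = let o , o∉ , on′ = outer j f∈ in mixed on on′ (Y≢O e∈Y o∉)
    attachedZ : ∀ j {f e} → f ∈ bag D¹ j → e ∈ˢ Z → On f e → f ∈ top
    attachedZ zero f∈ _ _ = f∈
    attachedZ (suc j) f∈ e∈Z on = let o , o∉ , on′ = outer j f∈ in mixed on on′ (Z≢O e∈Z o∉)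
    outerY : ∀ j {f} → f ∈ bag D¹ j → ∃[ e ] (e ∉ˢ Y × On f e)
    outerY zero f∈ = some-not-in Y (λ p q → inj₁ (p , q)) f∈
    outerY (suc j) f∈ = let o , o∉ , on = outer j f∈ in o , o∉ ∘ Y⊆X , on
    outerZ : ∀ j {f} → f ∈ bag D¹ j → ∃[ e ] (e ∉ˢ Z × On f e)
    outerZ zero f∈ = some-not-in Z (λ p q → inj₂ (inj₁ (p , q))) f∈
    outerZ (suc j) f∈ = let o , o∉ , on = outer j f∈ in o , o∉ ∘ Z⊆X , on
    E¹ : Extension D¹ Y
    E¹ = extY D¹ zero bnd¹ outerY attachedY
    outerZ² : ∀ j {f} → f ∈ bag (result E¹) j → ∃[ e ] (e ∉ˢ Z × On f e)
    outerZ² j f∈ =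
      [ (λ (j′ , f∈′) → outerZ j′ f∈′)
      , (λ (e , e∈Y , on) → e , disjoint e∈Y , on) ]′ (origin E¹ j f∈)
    attachedZ² : ∀ j {f e} → f ∈ bag (result E¹) j → e ∈ˢ Z → On f e → f ∈ bag (result E¹) (embed E¹ zero)
    attachedZ² j {f} f∈ e∈Z on = subst (f ∈_) (sym (bag-eq E¹ zero))
      ([ (λ (j′ , f∈′) → attachedZ j′ f∈′ e∈Z on)
       , (λ (_ , e′∈Y , on′) → mixed on′ on (Y≢Z e′∈Y e∈Z)) ]′ (origin E¹ j f∈))
    E² : Extension (result E¹) Z
    E² = extZ (result E¹) (embed E¹ zero) (bounded E¹) outerZ² attachedZ²

  extend : ∀ {X} → Good X → Extendable X
  extend (leaf e e∈X only-e) = extend-singleton e e∈X only-e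
  extend {X} (branch Y Z Y⊆X Z⊆X split disjoint neY neZ neO cY cZ cO t narrow goodY goodZ) =
    extend-union Y⊆X Z⊆X split disjoint mixeds (mixeds-≤ neY neZ neO cY cZ cO narrow)
      (λ { (x , fx , refl) (y , fy , refl) ne →
             subst (_∈ mixeds) fx (mixed-intro {x} {y} (trans fx (sym fy)) λ eq → ne (same-part⁻ eq)) })
      (λ f∈ → let x , y , fx , fy , ne = mixed-elim f∈ in
        hyp x , hyp y , (x , fx , refl) , (y , fy , refl) , ne ∘ same-part)
      (extend goodY) (extend goodZ)
    where open Parts {X} {Y} {Z} Y⊆X Z⊆X split disjoint

  opaque
    -- The starting node is the leaf for `e₀`, the one hyperedge left out of `all-but-root`, and the
    -- whole arrangement of the others is hung at it.
    full : Extension (start (faces-of e₀)) all-but-root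
    full = extend (all-but-root-good e₁≢e₀) (start (faces-of e₀)) zero (λ _ → faces-of-≤ e₀)
      (λ _ f∈ → e₀ , (λ e₀∈ → ∈⟪⟫⁻ not-root? e₀∈ refl) , proj₂ (∈-filter⁻ (on? e₀) {xs = allFin nF} f∈))
      (λ _ f∈ _ _ → f∈)

  open Extension full

  covers-all : ∀ e → ∃[ j ] (∀ {f} → On f e → f ∈ bag result j)
  covers-all e with e ≟ e₀
  ... | no ne = covers (∈⟪⟫⁺ not-root? ne)
  ... | yes refl = embed zero , λ {f} on → subst (f ∈_) (sym (bag-eq zero)) (∈-filter⁺ (on? e₀) (∈-allFin _) on)

  in-bag : ∀ {j x} → face x ∈ bag result j → ∃[ u ] (u ∈ map face-rep (bag result j) × SameFace u x)
  in-bag f∈ = _ , ∈-map⁺ face-rep f∈ , face⇒ (face-face-rep _)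

  in-bag⁻ : ∀ {j x} → ∃[ u ] (u ∈ map face-rep (bag result j) × SameFace u x) → face x ∈ bag result j
  in-bag⁻ (u , u∈ , same) with ∈-map⁻ face-rep u∈
  ... | f , f∈ , refl = subst (_∈ _) (trans (sym (face-face-rep f)) (⇒face same)) f∈

  dual-decomposition : TreeDecomposition (dualHG H) ((w + 1 + k) ⊔ (a ∸ 1))
  dual-decomposition = record
    { m = size ; T = tree result ; bag = λ j → map face-rep (bag result j)
    ; bag-vertices = λ _ _ → tt
    ; width = λ j → ≤-trans (≤-reflexive (length-map face-rep (bag result j))) (bounded j)
    ; cover-vertex = λ x _ → let j , cov = covers-all (hyp x) in j , in-bag (cov (x , refl , refl))
    ; cover-edge = λ e col-e → let j , cov = covers-all (hyp e) in
        j , λ f _ inc → in-bag (cov (on-face col-e inc))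
    ; interpolate = λ { x y z (p , (hd , lst , lp , up) , y∈) f f∈x f∈z →
        in-bag (interpolateᴳ result p lp up hd lst y∈ (in-bag⁻ f∈x) (in-bag⁻ f∈z)) } }
    where
    on-face : ∀ {e f} → col e ≡ true → FaceIncident e f → On (face f) (hyp e)
    on-face col-e (g , same-node , same-face) = g , ⇒face same-face
      , ⇒hyp (trans (cong node (centre-true (trans (sym (col-node same-node)) col-e)))
          (trans (sym (⇒node same-node)) (cong node (sym (centre-true col-e)))))

theorem1 : (H : SurfaceHypergraph) (k : ℕ) → EulerGenus H k
    → AtLeastTwoHyperedges H
    → (∀ v → ¬ Pending H v)
    → (∀ e → ¬ CutEdge H e)
    → (w a : ℕ) → TreeDecomposition (primalHG H) w → DualRankAtMost H a
    → TreeDecomposition (dualHG H) ((w + 1 + k) ⊔ (a ∸ 1))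
theorem1 H k (_ , _ , _ , nodes , edges , faces , euler) two _ no-cut w a td rank =
  Dual.dual-decomposition H (classes nodes) (classes faces) (classes edges) euler two no-cut td rank
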